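{- Let $k$ and $\ell$ be positive integers with $1\leq \ell\leq \sqrt{k}/4$ and let $G$ be a graph on $n\geq k$ vertices. Then the number of $k$-vertex subsets $A\subseteq V(G)$ such that the induced subgraph $G[A]$ is a forest with exactly $\ell$ edges is at most \[50\cdot \ell^{ -1/2}\cdot \frac{n^k}{k!}.\]
   Context: Graphs are finite and simple. -}

module Defs where

open import Data.Bool using (Bool; true; false; _∧_)
open import Data.Nat using (ℕ; suc; _<ᵇ_)
open import Data.Fin using (Fin; zero; suc; toℕ; inject₁; fromℕ)
open import Data.Fin.Subset using (Subset)
open import Data.Vec using (lookup)
open import Data.List using (List; length; filterᵇ; cartesianProduct; allFin)
open import Data.Product using (Σ; _×_; _,_)
open import Function.Definitions using (Injective)
open import Relation.Binary.PropositionalEquality using (_≡_)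
open import Relation.Nullary using (¬_)

record Graph (n : ℕ) : Set where
  field
    adj       : Fin n → Fin n → Bool
    adj-sym   : ∀ i j → adj i j ≡ adj j i
    adj-irrfl : ∀ i → adj i i ≡ false
open Graph public

inS : ∀ {n} → Subset n → Fin n → Bool
inS A i = lookup A i

edgesIn : ∀ {n} → Graph n → Subset n → ℕ
edgesIn {n} G A =
  length (filterᵇ (λ p → test p) (cartesianProduct (allFin n) (allFin n)))
  where
  test : Fin n × Fin n → Bool
  test (i , j) = (toℕ i <ᵇ toℕ j) ∧ (inS A i ∧ (inS A j ∧ adj G i j))

-- A cycle in G[A] of length m + 2 ≥ 3 (m ≥ 1): injective vertex sequence
-- f 0, …, f (m+1), all in A, consecutive ones adjacent, and f (m+1) adjacent to f 0.
record CycleIn {n} (G : Graph n) (A : Subset n) (m : ℕ) : Set where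
  field
    vert    : Fin (suc (suc m)) → Fin n
    inj     : Injective _≡_ _≡_ vert
    inA     : ∀ i → inS A (vert i) ≡ true
    step    : ∀ (i : Fin (suc m)) → adj G (vert (inject₁ i)) (vert (suc i)) ≡ true
    closing : adj G (vert (fromℕ (suc m))) (vert zero) ≡ true

IsForest : ∀ {n} → Graph n → Subset n → Set
IsForest G A = ∀ m → 1 Data.Nat.≤ m → ¬ CycleIn G A m

{-# OPTIONS --safe #-}
module Submission where

-- Write d_A(x) for the number of neighbours of x in A, ν(A) for the number of
-- non-isolated vertices of G[A], and N[A] for the closed neighbourhood of A.  Let p_j be the
-- probability that j random vertices are distinct and span exactly ℓ edges, with ν = v fixed.
--
-- (1) Add the vertices one at a time.  The number of edges never decreases, and it reaches ℓ
-- for the first time at step j with probability (ν/j) p_j, because the last vertex must be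
-- non-isolated.  Hence ∑_j (ν/j) p_j ≤ 1.
--
-- (2) The mass p_k cannot sit on few levels.  Adding an isolated vertex to A, or deleting one,
-- keeps ℓ and ν, so mass moves from level j to level j + 1 with the ratio
-- (1 − |N[A]|/n) / (1 − ν/(j+1)).  Where |N[A]|/n is below about ν/k the mass can be pushed
-- up, elsewhere it can be pushed down.  Deleting one of the vertices of A removes only |N[A]|
-- elements of N[A] when summed over all choices, so |N[A]| changes slowly, and a Lipschitz
-- cutoff at |N[A]|/n = (1 ± 1/R) ν/k with R ≈ √(2ℓ) loses only a constant factor over k/R
-- levels.  So p_k ≲ (R/k) ∑ p_j over |j − k| ≤ k/R.
--
-- (3) A forest with ℓ edges has ℓ ≤ ν ≤ 2ℓ, so (1) and (2) give p_k ≲ R/ℓ ≲ ℓ^(-1/2).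

open import Defs
open import Data.Bool using (Bool; true; false; not; if_then_else_; T; _∧_)
open import Data.Bool.Properties using () renaming (_≟_ to _≟ᵇ_)
open import Data.Empty using (⊥-elim)
open import Data.Fin using (Fin; zero; suc; toℕ; inject₁; inject≤; fromℕ)
open import Data.Fin.Properties using (any?; toℕ-injective; toℕ-inject₁; toℕ-inject≤; toℕ-fromℕ; inject≤-injective; injective⇒≤; toℕ<n) renaming (_≟_ to _≟ᶠ_)
open import Data.Fin.Subset using (Subset; ∣_∣)
open import Data.List as List using (List; length; filterᵇ; cartesianProduct)
open import Data.List.Relation.Unary.All as All using (All)
open import Data.List.Relation.Unary.AllPairs using ([]; _∷_)
open import Data.List.Relation.Unary.Unique.Propositional using (Unique)
open import Data.Nat
open import Data.Nat.DivMod using (m/n*n≤m; m≡m%n+[m/n]*n; m%n<n)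
open import Data.Nat.Properties
open import Data.Nat.Tactic.RingSolver using (solve-∀)
open import Data.Product using (_×_; _,_; ∃)
open import Data.Sum using (inj₁; inj₂)
open import Data.Unit using (tt)
open import Data.Vec using ([]; _∷_; lookup; _[_]≔_)
open import Data.Vec.Properties using (≡-dec; lookup∘update; lookup∘update′)
open import Function using (_∘_; id)
open import Function.Definitions using (Injective)
open import Relation.Nullary using (¬_; Dec; yes; no; does; ¬?; _×-dec_)
open import Relation.Binary.PropositionalEquality

open import Algebra.Properties.CommutativeSemigroup +-commutativeSemigroup using (interchange) renaming (x∙yz≈y∙xz to +-swap)
open import Algebra.Properties.CommutativeSemigroup *-commutativeSemigroup using () renaming (x∙yz≈y∙xz to *-swap)
open import Algebra.Properties.Semiring.Sum +-*-semiring using (sum; sum-cong-≗; ∑-distrib-+; ∑-comm; *-distribˡ-sum; *-distribʳ-sum; sum-replicate-zero)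

private variable
  n : ℕ

-- Sums over indices and over subsets

sum-mono : {f g : Fin n → ℕ} → (∀ i → f i ≤ g i) → sum f ≤ sum g
sum-mono {zero}  f≤g = z≤n
sum-mono {suc n} f≤g = +-mono-≤ (f≤g zero) (sum-mono (f≤g ∘ suc))

sum-term : (f : Fin n → ℕ) (i : Fin n) → f i ≤ sum f
sum-term f zero    = m≤m+n _ _
sum-term f (suc i) = ≤-trans (sum-term (f ∘ suc) i) (m≤n+m _ _)

sum-zero : {f : Fin n → ℕ} → (∀ i → f i ≡ 0) → sum f ≡ 0
sum-zero {n} f≡0 = trans (sum-cong-≗ f≡0) (sum-replicate-zero n)

sum-one : {f : Fin n → ℕ} → (∀ i → f i ≡ 1) → sum f ≡ n
sum-one {zero}  f≡1 = refl
sum-one {suc n} f≡1 = cong₂ _+_ (f≡1 zero) (sum-one (f≡1 ∘ suc))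

∑ₛ : (Subset n → ℕ) → ℕ
∑ₛ {zero}  f = f []
∑ₛ {suc n} f = ∑ₛ (f ∘ (true ∷_)) + ∑ₛ (f ∘ (false ∷_))

∑ₛ-cong : {f g : Subset n → ℕ} → (∀ A → f A ≡ g A) → ∑ₛ f ≡ ∑ₛ g
∑ₛ-cong {zero}  f≡g = f≡g []
∑ₛ-cong {suc n} f≡g = cong₂ _+_ (∑ₛ-cong (f≡g ∘ (true ∷_))) (∑ₛ-cong (f≡g ∘ (false ∷_)))

∑ₛ-mono : {f g : Subset n → ℕ} → (∀ A → f A ≤ g A) → ∑ₛ f ≤ ∑ₛ g
∑ₛ-mono {zero}  f≤g = f≤g []
∑ₛ-mono {suc n} f≤g = +-mono-≤ (∑ₛ-mono (f≤g ∘ (true ∷_))) (∑ₛ-mono (f≤g ∘ (false ∷_)))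

∑ₛ-+ : (f g : Subset n → ℕ) → ∑ₛ (λ A → f A + g A) ≡ ∑ₛ f + ∑ₛ g
∑ₛ-+ {zero}  f g = refl
∑ₛ-+ {suc n} f g = trans
  (cong₂ _+_ (∑ₛ-+ (f ∘ (true ∷_)) (g ∘ (true ∷_))) (∑ₛ-+ (f ∘ (false ∷_)) (g ∘ (false ∷_))))
  (interchange (∑ₛ (f ∘ (true ∷_))) _ _ _)

∑ₛ-* : ∀ c (f : Subset n → ℕ) → ∑ₛ (λ A → c * f A) ≡ c * ∑ₛ f
∑ₛ-* {zero}  c f = refl
∑ₛ-* {suc n} c f = trans (cong₂ _+_ (∑ₛ-* c (f ∘ (true ∷_))) (∑ₛ-* c (f ∘ (false ∷_))))
  (sym (*-distribˡ-+ c (∑ₛ (f ∘ (true ∷_))) _))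

∑ₛ-zero : ∀ n → ∑ₛ {n} (λ _ → 0) ≡ 0
∑ₛ-zero n = ∑ₛ-* {n} 0 (λ _ → 0)

𝟙 : Bool → ℕ
𝟙 b = if b then 1 else 0

-- Each pair (B , x) with x ∉ B is (A − x , x) for a unique pair (A , x) with x ∈ A.
∑ₛ-delete : (g : Subset n → Fin n → ℕ) →
  ∑ₛ (λ B → sum (λ x → 𝟙 (not (lookup B x)) * g B x)) ≡
  ∑ₛ (λ A → sum (λ x → 𝟙 (lookup A x) * g (A [ x ]≔ false) x))
∑ₛ-delete {zero}  g = refl
∑ₛ-delete {suc n} g = begin
  -- `Z` is the contribution of x = `zero`: it belongs to the sets with head `false` on the left and
  -- to those with head `true` on the right.
  ∑ₛ (λ B → F true B) + ∑ₛ (λ B → (g (false ∷ B) zero + 0) + F false B)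
    ≡⟨ cong₂ _+_ (ih true) (trans (∑ₛ-+ (λ B → g (false ∷ B) zero + 0) (F false)) (cong (Z +_) (ih false))) ⟩
  ∑ₛ (H true) + (Z + ∑ₛ (H false))
    ≡⟨ shuffle (∑ₛ (H true)) Z _ ⟩
  (Z + ∑ₛ (H true)) + ∑ₛ (H false)
    ≡⟨ cong (_+ ∑ₛ (H false)) (∑ₛ-+ (λ B → g (false ∷ B) zero + 0) (H true)) ⟨
  ∑ₛ (λ A → (g (false ∷ A) zero + 0) + H true A) + ∑ₛ (H false) ∎
  where
  open ≡-Reasoning
  F H : Bool → Subset n → ℕ
  F b B = sum (λ x → 𝟙 (not (lookup B x)) * g (b ∷ B) (suc x))
  H b A = sum (λ x → 𝟙 (lookup A x) * g (b ∷ (A [ x ]≔ false)) (suc x))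
  Z = ∑ₛ (λ B → g (false ∷ B) zero + 0)
  ih : ∀ b → ∑ₛ (F b) ≡ ∑ₛ (H b)
  ih b = ∑ₛ-delete (λ B x → g (b ∷ B) (suc x))
  shuffle : ∀ a b c → a + (b + c) ≡ (b + a) + c
  shuffle = solve-∀

-- Repetition-free lists of subsets as sums over subsets

_≟ₛ_ : (A B : Subset n) → Dec (A ≡ B)
_≟ₛ_ = ≡-dec _≟ᵇ_

multiplicity : List (Subset n) → Subset n → ℕ
multiplicity List.[]       B = 0
multiplicity (A List.∷ As) B = 𝟙 (does (A ≟ₛ B)) + multiplicity As B

∑ₛ-point : (A : Subset n) → ∑ₛ (λ B → 𝟙 (does (A ≟ₛ B))) ≡ 1
∑ₛ-point []                  = refl
∑ₛ-point {suc n} (true  ∷ A) = cong₂ _+_ (∑ₛ-point A) (∑ₛ-zero n)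
∑ₛ-point {suc n} (false ∷ A) = cong₂ _+_ (∑ₛ-zero n) (∑ₛ-point A)

∑ₛ-multiplicity : (As : List (Subset n)) → ∑ₛ (multiplicity As) ≡ length As
∑ₛ-multiplicity {n} List.[]   = ∑ₛ-zero n
∑ₛ-multiplicity (A List.∷ As) = trans
  (∑ₛ-+ (λ B → 𝟙 (does (A ≟ₛ B))) (multiplicity As))
  (cong₂ _+_ (∑ₛ-point A) (∑ₛ-multiplicity As))

multiplicity-absent : {A : Subset n} {As : List (Subset n)} → All (λ B → A ≢ B) As → multiplicity As A ≡ 0
multiplicity-absent All.[] = refl
multiplicity-absent {A = A} {B List.∷ As} (A≢B All.∷ rest) with B ≟ₛ A
... | yes B≡A = ⊥-elim (A≢B (sym B≡A))
... | no _    = multiplicity-absent rest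

-- By uniqueness a listed set has multiplicity exactly one, and for it the hypothesis gives c ≤ f;
-- every other set has multiplicity 0.
multiplicity-weight : ∀ c (f : Subset n → ℕ) {As : List (Subset n)} → Unique As → All (λ A → c ≤ f A) As →
  ∀ B → c * multiplicity As B ≤ f B
multiplicity-weight c f [] All.[] B = ≤-trans (≤-reflexive (*-zeroʳ c)) z≤n
multiplicity-weight c f {A List.∷ As} (A∉As ∷ unique) (c≤fA All.∷ c≤f) B with A ≟ₛ B
... | no _     = multiplicity-weight c f unique c≤f B
... | yes refl = begin
  c * (1 + multiplicity As A) ≡⟨ cong (λ t → c * (1 + t)) (multiplicity-absent A∉As) ⟩
  c * 1                       ≡⟨ *-identityʳ c ⟩
  c                           ≤⟨ c≤fA ⟩
  f A                         ∎
  where open ≤-Reasoning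

-- The passage from the list of the theorem to subset sums: applied with c = 1 to `sparse`, and with
-- c = ℓ to the summand of `hits`.
length-weight : ∀ c (f : Subset n → ℕ) {As : List (Subset n)} → Unique As → All (λ A → c ≤ f A) As →
  c * length As ≤ ∑ₛ f
length-weight c f {As} unique c≤f = begin
  c * length As                       ≡⟨ cong (c *_) (∑ₛ-multiplicity As) ⟨
  c * ∑ₛ (multiplicity As)            ≡⟨ ∑ₛ-* c (multiplicity As) ⟨
  ∑ₛ (λ B → c * multiplicity As B)    ≤⟨ ∑ₛ-mono (multiplicity-weight c f unique c≤f) ⟩
  ∑ₛ f                                ∎
  where open ≤-Reasoning

-- Degrees, isolated vertices and closed neighbourhoods

sgn nul : ℕ → ℕ
sgn 0       = 0
sgn (suc _) = 1
nul 0       = 1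
nul (suc _) = 0

sgn≤ : ∀ m → sgn m ≤ m
sgn≤ zero    = z≤n
sgn≤ (suc m) = s≤s z≤n

sgn-mono : ∀ {m m′} → m ≤ m′ → sgn m ≤ sgn m′
sgn-mono z≤n     = z≤n
sgn-mono (s≤s _) = ≤-refl

nul+sgn : ∀ m → nul m + sgn m ≡ 1
nul+sgn zero    = refl
nul+sgn (suc m) = refl

𝟙≤1 : ∀ b → 𝟙 b ≤ 1
𝟙≤1 true  = ≤-refl
𝟙≤1 false = z≤n

point : Fin n → Fin n → ℕ
point x y = 𝟙 (does (y ≟ᶠ x))

sum-point : (x : Fin n) (f : Fin n → ℕ) → sum (λ y → point x y * f y) ≡ f x
sum-point {suc n} zero f = trans (cong₂ _+_ (+-identityʳ (f zero)) (sum-replicate-zero n)) (+-identityʳ _)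
sum-point (suc x) f = sum-point x (f ∘ suc)

el : Subset n → Fin n → ℕ
el A x = 𝟙 (lookup A x)

infixl 6 _─_
_─_ : Subset n → Fin n → Subset n
A ─ x = A [ x ]≔ false

lookup-─-≢ : (A : Subset n) {x y : Fin n} → y ≢ x → lookup (A ─ x) y ≡ lookup A y
lookup-─-≢ A y≢x = lookup∘update′ y≢x A false

lookup-─-⊆ : (A : Subset n) (x : Fin n) {y : Fin n} → lookup (A ─ x) y ≡ true → lookup A y ≡ true
lookup-─-⊆ A x {y} y∈ with y ≟ᶠ x
... | no y≢x   = trans (sym (lookup-─-≢ A y≢x)) y∈
... | yes refl with () ← trans (sym (lookup∘update y A false)) y∈

el-─ : (A : Subset n) {x : Fin n} → lookup A x ≡ true → ∀ y → el A y ≡ el (A ─ x) y + point x y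
el-─ A {x} x∈A y with y ≟ᶠ x
... | no y≢x   = trans (cong 𝟙 (sym (lookup-─-≢ A y≢x))) (sym (+-identityʳ _))
... | yes refl = trans (cong 𝟙 x∈A) (cong (λ b → 𝟙 b + 1) (sym (lookup∘update y A false)))

∣∣≡sum : (A : Subset n) → ∣ A ∣ ≡ sum (el A)
∣∣≡sum []          = refl
∣∣≡sum (true  ∷ A) = cong suc (∣∣≡sum A)
∣∣≡sum (false ∷ A) = ∣∣≡sum A

sum-el-─ : (A : Subset n) {x : Fin n} → lookup A x ≡ true → (f : Fin n → ℕ) →
  sum (λ y → el A y * f y) ≡ sum (λ y → el (A ─ x) y * f y) + f x
sum-el-─ A {x} x∈A f = begin
  sum (λ y → el A y * f y)
    ≡⟨ sum-cong-≗ (λ y → trans (cong (_* f y) (el-─ A x∈A y)) (*-distribʳ-+ (f y) (el (A ─ x) y) (point x y))) ⟩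
  sum (λ y → el (A ─ x) y * f y + point x y * f y)
    ≡⟨ ∑-distrib-+ (λ y → el (A ─ x) y * f y) (λ y → point x y * f y) ⟩
  sum (λ y → el (A ─ x) y * f y) + sum (λ y → point x y * f y)
    ≡⟨ cong (sum (λ y → el (A ─ x) y * f y) +_) (sum-point x f) ⟩
  sum (λ y → el (A ─ x) y * f y) + f x ∎
  where open ≡-Reasoning

∣∣-─ : (A : Subset n) {x : Fin n} → lookup A x ≡ true → ∣ A ∣ ≡ suc ∣ A ─ x ∣
∣∣-─ A {x} x∈A = begin
  ∣ A ∣                                ≡⟨ ∣∣≡sum·1 A ⟩
  sum (λ y → el A y * 1)              ≡⟨ sum-el-─ A x∈A (λ _ → 1) ⟩
  sum (λ y → el (A ─ x) y * 1) + 1    ≡⟨ cong (_+ 1) (∣∣≡sum·1 (A ─ x)) ⟨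
  ∣ A ─ x ∣ + 1                        ≡⟨ +-comm _ 1 ⟩
  suc ∣ A ─ x ∣                        ∎
  where
  open ≡-Reasoning
  ∣∣≡sum·1 : ∀ B → ∣ B ∣ ≡ sum (λ y → el B y * 1)
  ∣∣≡sum·1 B = trans (∣∣≡sum B) (sum-cong-≗ (λ y → sym (*-identityʳ (el B y))))

module _ (G : Graph n) where

  edge : Fin n → Fin n → ℕ
  edge x y = 𝟙 (adj G x y)

  edge-sym : ∀ x y → edge x y ≡ edge y x
  edge-sym x y = cong 𝟙 (adj-sym G x y)

  edge-irrefl : ∀ x → edge x x ≡ 0
  edge-irrefl x = cong 𝟙 (adj-irrfl G x)

  deg : Subset n → Fin n → ℕ
  deg A x = sum (λ y → el A y * edge x y)

  -- `nonisolated` is ν(A), and `degreeSum` is twice the number of edges. `nonneighbours` counts the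
  -- vertices outside N[A], which are those that can be added to A as isolated vertices.
  isolated nonisolated degreeSum coverage nonneighbours : Subset n → ℕ
  isolated    A = sum (λ x → el A x * nul (deg A x))
  nonisolated A = sum (λ x → el A x * sgn (deg A x))
  degreeSum   A = sum (λ x → el A x * deg A x)

  -- |A ∩ N[x]|, as a sum over A so that deleting a vertex removes a single summand; it is positive
  -- exactly on N[A].
  cover : Subset n → Fin n → ℕ
  cover A x = sum (λ y → el A y * (point x y + edge x y))

  -- |N[A]|
  coverage A = sum (λ x → sgn (cover A x))

  nonneighbours A = sum (λ x → 𝟙 (not (lookup A x)) * nul (deg A x))

  cover≡ : ∀ A x → cover A x ≡ el A x + deg A x
  cover≡ A x = begin
    cover A x
      ≡⟨ sum-cong-≗ (λ y → trans (*-distribˡ-+ (el A y) (point x y) (edge x y)) (cong (_+ el A y * edge x y) (*-comm (el A y) (point x y)))) ⟩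
    sum (λ y → point x y * el A y + el A y * edge x y)
      ≡⟨ ∑-distrib-+ (λ y → point x y * el A y) (λ y → el A y * edge x y) ⟩
    sum (λ y → point x y * el A y) + deg A x
      ≡⟨ cong (_+ deg A x) (sum-point x (el A)) ⟩
    el A x + deg A x ∎
    where open ≡-Reasoning

  isolated+nonisolated : ∀ A → isolated A + nonisolated A ≡ ∣ A ∣
  isolated+nonisolated A = trans (sym (∑-distrib-+ (λ x → el A x * nul (deg A x)) _)) (trans (sum-cong-≗ pointwise) (sym (∣∣≡sum A)))
    where
    pointwise : ∀ x → el A x * nul (deg A x) + el A x * sgn (deg A x) ≡ el A x
    pointwise x = trans (sym (*-distribˡ-+ (el A x) _ _)) (trans (cong (el A x *_) (nul+sgn (deg A x))) (*-identityʳ _))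

  nonneighbours+coverage : ∀ A → nonneighbours A + coverage A ≡ n
  nonneighbours+coverage A = trans (sym (∑-distrib-+ (λ x → 𝟙 (not (lookup A x)) * nul (deg A x)) _)) (sum-one pointwise)
    where
    pointwise : ∀ x → 𝟙 (not (lookup A x)) * nul (deg A x) + sgn (cover A x) ≡ 1
    pointwise x rewrite cover≡ A x with lookup A x
    ... | true  = refl
    ... | false = trans (cong (_+ sgn (deg A x)) (+-identityʳ _)) (nul+sgn (deg A x))

  nonisolated≤degreeSum : ∀ A → nonisolated A ≤ degreeSum A
  nonisolated≤degreeSum A = sum-mono (λ x → *-monoʳ-≤ (el A x) (sgn≤ (deg A x)))

  module _ (A : Subset n) {x : Fin n} (x∈A : lookup A x ≡ true) where

    deg-─ : ∀ y → deg A y ≡ deg (A ─ x) y + edge y x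
    deg-─ y = sum-el-─ A x∈A (edge y)

    deg-─-self : deg A x ≡ deg (A ─ x) x
    deg-─-self = trans (deg-─ x) (trans (cong (deg (A ─ x) x +_) (edge-irrefl x)) (+-identityʳ _))

    cover-─ : ∀ y → cover A y ≡ cover (A ─ x) y + (point y x + edge y x)
    cover-─ y = sum-el-─ A x∈A (λ z → point y z + edge y z)

    -- The deleted vertex takes its own degree along and lowers the degree of each of its neighbours
    -- in A by one.
    degreeSum-─ : degreeSum A ≡ degreeSum (A ─ x) + (deg A x + deg A x)
    degreeSum-─ = begin
      degreeSum A
        ≡⟨ sum-el-─ A x∈A (deg A) ⟩
      sum (λ y → el (A ─ x) y * deg A y) + deg A x
        ≡⟨ cong (_+ deg A x) (sum-cong-≗ (λ y → trans (cong (el (A ─ x) y *_) (trans (deg-─ y) (cong (deg (A ─ x) y +_) (edge-sym y x)))) (*-distribˡ-+ (el (A ─ x) y) _ _))) ⟩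
      sum (λ y → el (A ─ x) y * deg (A ─ x) y + el (A ─ x) y * edge x y) + deg A x
        ≡⟨ cong (_+ deg A x) (∑-distrib-+ (λ y → el (A ─ x) y * deg (A ─ x) y) _) ⟩
      degreeSum (A ─ x) + deg (A ─ x) x + deg A x
        ≡⟨ cong (λ t → degreeSum (A ─ x) + t + deg A x) deg-─-self ⟨
      degreeSum (A ─ x) + deg A x + deg A x
        ≡⟨ +-assoc (degreeSum (A ─ x)) _ _ ⟩
      degreeSum (A ─ x) + (deg A x + deg A x) ∎
      where open ≡-Reasoning

    -- Only an inequality, since neighbours of x that have no other neighbour in A become isolated
    -- as well.
    nonisolated-─ : nonisolated (A ─ x) + sgn (deg A x) ≤ nonisolated A
    nonisolated-─ = begin
      nonisolated (A ─ x) + sgn (deg A x)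
        ≤⟨ +-monoˡ-≤ _ (sum-mono (λ y → *-monoʳ-≤ (el (A ─ x) y) (sgn-mono (≤-trans (m≤m+n _ _) (≤-reflexive (sym (deg-─ y))))))) ⟩
      sum (λ y → el (A ─ x) y * sgn (deg A y)) + sgn (deg A x)
        ≡⟨ sum-el-─ A x∈A (sgn ∘ deg A) ⟨
      nonisolated A ∎
      where open ≤-Reasoning

    nonisolated-─-isolated : deg A x ≡ 0 → nonisolated (A ─ x) ≡ nonisolated A
    nonisolated-─-isolated d≡0 = sym (begin
      nonisolated A
        ≡⟨ sum-el-─ A x∈A (sgn ∘ deg A) ⟩
      sum (λ y → el (A ─ x) y * sgn (deg A y)) + sgn (deg A x)
        ≡⟨ cong₂ _+_ (sum-cong-≗ same) (cong sgn d≡0) ⟩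
      nonisolated (A ─ x) + 0
        ≡⟨ +-identityʳ _ ⟩
      nonisolated (A ─ x) ∎)
      where
      open ≡-Reasoning
      noedge : ∀ y → el (A ─ x) y * edge x y ≡ 0
      noedge y = n≤0⇒n≡0 (≤-trans (sum-term (λ z → el (A ─ x) z * edge x z) y) (≤-reflexive (trans (sym deg-─-self) d≡0)))
      same : ∀ y → el (A ─ x) y * sgn (deg A y) ≡ el (A ─ x) y * sgn (deg (A ─ x) y)
      same y with lookup (A ─ x) y in eq
      ... | false = refl
      ... | true  = cong (λ t → 1 * sgn t) (trans (deg-─ y) (trans (cong (deg (A ─ x) y +_) e≡0) (+-identityʳ _)))
        where
        e≡0 : edge y x ≡ 0
        e≡0 = trans (edge-sym y x) (trans (sym (+-identityʳ _)) (subst (λ b → 𝟙 b * edge x y ≡ 0) eq (noedge y)))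

  loss : Subset n → Fin n → ℕ
  loss A x = sum (λ y → sgn (cover A y) ∸ sgn (cover (A ─ x) y))

  coverage-─ : ∀ A x → coverage A ≤ coverage (A ─ x) + loss A x
  coverage-─ A x = ≤-trans
    (sum-mono (λ y → m≤n+m∸n (sgn (cover A y)) (sgn (cover (A ─ x) y))))
    (≤-reflexive (∑-distrib-+ (λ y → sgn (cover (A ─ x) y)) _))

  -- A vertex y is lost only through its sole cover, so it is lost at most once in total.
  sum-loss≤coverage : ∀ A → sum (λ x → el A x * loss A x) ≤ coverage A
  sum-loss≤coverage A = begin
    sum (λ x → el A x * loss A x)
      ≡⟨ sum-cong-≗ (λ x → *-distribˡ-sum (el A x) (λ y → lost x y)) ⟩
    sum (λ x → sum (λ y → el A x * lost x y))
      ≡⟨ ∑-comm (λ x y → el A x * lost x y) ⟩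
    sum (λ y → sum (λ x → el A x * lost x y))
      ≤⟨ sum-mono once ⟩
    coverage A ∎
    where
    open ≤-Reasoning
    lost : Fin n → Fin n → ℕ
    lost x y = sgn (cover A y) ∸ sgn (cover (A ─ x) y)
    -- If deleting x uncovers y, the summand w of x is the whole cover c of y. Summed over x these w
    -- give c again, and cancelling c leaves at most one loss.
    sole : ∀ c c′ w → c ≡ c′ + w → c * (sgn c ∸ sgn c′) ≤ w
    sole c       (suc c′) w refl = ≤-trans (≤-reflexive (*-zeroʳ c)) z≤n
    sole zero    zero     w eq   = z≤n
    sole (suc c) zero     w refl = ≤-reflexive (*-identityʳ w)
    weighted : ∀ y x → cover A y * (el A x * lost x y) ≤ el A x * (point y x + edge y x)
    weighted y x with lookup A x in eq
    ... | false = ≤-reflexive (*-zeroʳ (cover A y))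
    ... | true  = ≤-trans (≤-reflexive (cong (cover A y *_) (+-identityʳ _)))
      (≤-trans (sole (cover A y) (cover (A ─ x) y) _ (cover-─ A eq y)) (≤-reflexive (sym (+-identityʳ _))))
    total : ∀ y → cover A y * sum (λ x → el A x * lost x y) ≤ cover A y
    total y = ≤-trans (≤-reflexive (*-distribˡ-sum (cover A y) (λ x → el A x * lost x y))) (sum-mono (weighted y))
    finish : ∀ c t → c * t ≤ c → (c ≡ 0 → t ≡ 0) → t ≤ sgn c
    finish zero    t _ t≡0 = ≤-reflexive (t≡0 refl)
    finish (suc c) t le _  = *-cancelˡ-≤ (suc c) (≤-trans le (≤-reflexive (sym (*-identityʳ (suc c)))))
    once : ∀ y → sum (λ x → el A x * lost x y) ≤ sgn (cover A y)
    once y = finish (cover A y) _ (total y) (λ c≡0 → sum-zero (λ x →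
      trans (cong (λ c → el A x * (sgn c ∸ sgn (cover (A ─ x) y))) c≡0) (trans (cong (el A x *_) (0∸n≡0 (sgn (cover (A ─ x) y)))) (*-zeroʳ (el A x)))))

-- Moving mass between consecutive levels

∸-superadditive : ∀ a b d → (a ∸ d) + (b ∸ d) ≤ (a + b) ∸ d
∸-superadditive a b d with ≤-total a d
... | inj₁ a≤d rewrite m≤n⇒m∸n≡0 a≤d = ∸-monoˡ-≤ d (m≤n+m b a)
... | inj₂ d≤a = begin
  (a ∸ d) + (b ∸ d) ≤⟨ +-monoʳ-≤ (a ∸ d) (m∸n≤m b d) ⟩
  (a ∸ d) + b       ≡⟨ +-∸-comm b d≤a ⟨
  (a + b) ∸ d       ∎
  where open ≤-Reasoning

sum-∸ : (f : Fin n → ℕ) (d : ℕ) → sum (λ i → f i ∸ d) ≤ sum f ∸ d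
sum-∸ {zero}  f d = z≤n
sum-∸ {suc n} f d = ≤-trans (+-monoʳ-≤ (f zero ∸ d) (sum-∸ (f ∘ suc) d)) (∸-superadditive (f zero) _ d)

module Cutoff (lo D : ℕ) where

  hi : ℕ
  hi = lo + D

  -- Piecewise linear: `below` is D up to `lo`, falls with slope 1 and is 0 from `hi` on; `above` is
  -- its complement to D.
  below above : ℕ → ℕ
  below q = D ⊓ (hi ∸ q)
  above q = D ⊓ (q ∸ lo)

  below+above : ∀ q → below q + above q ≡ D
  below+above q with ≤-total q lo
  ... | inj₁ q≤lo = begin
    D ⊓ (hi ∸ q) + D ⊓ (q ∸ lo)
      ≡⟨ cong₂ _+_ (m≤n⇒m⊓n≡m (≤-trans (≤-reflexive (sym (m+n∸m≡n lo D))) (∸-monoʳ-≤ hi q≤lo))) (cong (D ⊓_) (m≤n⇒m∸n≡0 q≤lo)) ⟩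
    D + D ⊓ 0
      ≡⟨ cong (D +_) (⊓-zeroʳ D) ⟩
    D + 0
      ≡⟨ +-identityʳ D ⟩
    D ∎
    where open ≡-Reasoning
  ... | inj₂ lo≤q = begin
    D ⊓ (hi ∸ q) + D ⊓ e
      ≡⟨ cong (λ t → D ⊓ (hi ∸ t) + D ⊓ e) (m+[n∸m]≡n lo≤q) ⟨
    D ⊓ (hi ∸ (lo + e)) + D ⊓ e
      ≡⟨ cong (λ t → D ⊓ t + D ⊓ e) ([m+n]∸[m+o]≡n∸o lo D e) ⟩
    D ⊓ (D ∸ e) + D ⊓ e
      ≡⟨ cong₂ _+_ (m≥n⇒m⊓n≡n (m∸n≤m D e)) (⊓-comm D e) ⟩
    (D ∸ e) + e ⊓ D
      ≡⟨ +-comm (D ∸ e) _ ⟩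
    e ⊓ D + (D ∸ e)
      ≡⟨ m⊓n+n∸m≡n e D ⟩
    D ∎
    where
    open ≡-Reasoning
    e = q ∸ lo

  below-support : ∀ q → q * below q ≤ hi * below q
  below-support q with ≤-total q hi
  ... | inj₁ q≤hi = *-monoˡ-≤ (below q) q≤hi
  ... | inj₂ hi≤q = ≤-trans (≤-reflexive (trans (cong (λ t → q * (D ⊓ t)) (m≤n⇒m∸n≡0 hi≤q)) (trans (cong (q *_) (⊓-zeroʳ D)) (*-zeroʳ q)))) z≤n

  above-support : ∀ q → lo * above q ≤ q * above q
  above-support q with ≤-total lo q
  ... | inj₁ lo≤q = *-monoˡ-≤ (above q) lo≤q
  ... | inj₂ q≤lo = ≤-trans (≤-reflexive (trans (cong (λ t → lo * (D ⊓ t)) (m≤n⇒m∸n≡0 q≤lo)) (trans (cong (lo *_) (⊓-zeroʳ D)) (*-zeroʳ lo)))) z≤n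

  -- The slope is 1, and if q exceeds `hi`, the first q - hi units of the drop happen where `hi ∸ q`
  -- is still 0. Subtracting them is what keeps the bound in `isoSum-loss` independent of q.
  hi∸-loss : ∀ q q′ l → q ≤ q′ + l → hi ∸ q′ ≤ (hi ∸ q) + (l ∸ (q ∸ hi))
  hi∸-loss q q′ l q≤ with ≤-total q hi
  ... | inj₁ q≤hi rewrite m≤n⇒m∸n≡0 q≤hi = m≤n+o⇒m∸n≤o hi q′ (begin
    hi                    ≡⟨ m∸n+n≡m q≤hi ⟨
    (hi ∸ q) + q          ≤⟨ +-monoʳ-≤ (hi ∸ q) q≤ ⟩
    (hi ∸ q) + (q′ + l)   ≡⟨ +-swap (hi ∸ q) q′ l ⟩
    q′ + ((hi ∸ q) + l)   ∎)
    where open ≤-Reasoning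
  ... | inj₂ hi≤q with ≤-total hi q′
  ...   | inj₁ hi≤q′ = ≤-trans (≤-reflexive (m≤n⇒m∸n≡0 hi≤q′)) z≤n
  ...   | inj₂ q′≤hi rewrite m≤n⇒m∸n≡0 hi≤q = m+n≤o⇒m≤o∸n (hi ∸ q′) (+-cancelˡ-≤ q′ _ _ (begin
    q′ + ((hi ∸ q′) + (q ∸ hi))   ≡⟨ +-assoc q′ _ _ ⟨
    q′ + (hi ∸ q′) + (q ∸ hi)     ≡⟨ cong (_+ (q ∸ hi)) (m+[n∸m]≡n q′≤hi) ⟩
    hi + (q ∸ hi)                 ≡⟨ m+[n∸m]≡n hi≤q ⟩
    q                             ≤⟨ q≤ ⟩
    q′ + l                        ∎))
    where open ≤-Reasoning

  below-loss : ∀ q q′ l → q ≤ q′ + l → below q′ ≤ below q + (l ∸ (q ∸ hi))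
  below-loss q q′ l q≤ = begin
    D ⊓ (hi ∸ q′)                        ≤⟨ ⊓-monoʳ-≤ D (hi∸-loss q q′ l q≤) ⟩
    D ⊓ ((hi ∸ q) + t)                   ≤⟨ ⊓-monoˡ-≤ _ (m≤m+n D t) ⟩
    (D + t) ⊓ ((hi ∸ q) + t)             ≡⟨ +-distribʳ-⊓ t D (hi ∸ q) ⟨
    below q + t                          ∎
    where
    open ≤-Reasoning
    t = l ∸ (q ∸ hi)

  above-loss : ∀ q q′ l → q ≤ q′ + l → above q ≤ above q′ + (l ∸ (q ∸ hi))
  above-loss q q′ l q≤ = +-cancelˡ-≤ (below q) _ _ (begin
    below q + above q           ≡⟨ trans (below+above q) (sym (below+above q′)) ⟩
    below q′ + above q′         ≤⟨ +-monoˡ-≤ (above q′) (below-loss q q′ l q≤) ⟩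
    below q + t + above q′      ≡⟨ shuffle (below q) t (above q′) ⟩
    below q + (above q′ + t)    ∎)
    where
    open ≤-Reasoning
    t = l ∸ (q ∸ hi)
    shuffle : ∀ a b c → a + b + c ≡ a + (c + b)
    shuffle = solve-∀

-- Classes of fixed size, ν and degree sum, and the flow between levels

δ : ℕ → ℕ → ℕ
δ a b = 𝟙 (a ≡ᵇ b)

δ-guard : ∀ a b {f g} → (a ≡ b → f ≤ g) → δ a b * f ≤ δ a b * g
δ-guard a b f≤g with a ≡ᵇ b in eq
... | false = z≤n
... | true  = +-monoˡ-≤ 0 (f≤g (≡ᵇ⇒≡ a b (subst T (sym eq) tt)))

module Levels (G : Graph n) (s v : ℕ) where

  cls : ℕ → Subset n → ℕ
  cls j A = δ ∣ A ∣ j * (δ (nonisolated G A) v * δ (degreeSum G A) s)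

  ∑ᶜ : ℕ → (Subset n → ℕ) → ℕ
  ∑ᶜ j f = ∑ₛ (λ A → cls j A * f A)

  count : ℕ → ℕ
  count j = ∑ᶜ j (λ _ → 1)

  cls-mono : ∀ j A {f g} → (∣ A ∣ ≡ j → nonisolated G A ≡ v → f ≤ g) → cls j A * f ≤ cls j A * g
  cls-mono j A {f} {g} f≤g = begin
    d * (a * b) * f     ≡⟨ assoc d a b f ⟩
    d * (a * (b * f))   ≤⟨ δ-guard (∣ A ∣) j (λ p → δ-guard (nonisolated G A) v (λ q → *-monoʳ-≤ b (f≤g p q))) ⟩
    d * (a * (b * g))   ≡⟨ assoc d a b g ⟨
    d * (a * b) * g     ∎
    where
    open ≤-Reasoning
    d = δ (∣ A ∣) j
    a = δ (nonisolated G A) v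
    b = δ (degreeSum G A) s
    assoc : ∀ x y z w → x * (y * z) * w ≡ x * (y * (z * w))
    assoc = solve-∀

  ∑ᶜ-mono : ∀ j {f g : Subset n → ℕ} → (∀ A → ∣ A ∣ ≡ j → nonisolated G A ≡ v → f A ≤ g A) → ∑ᶜ j f ≤ ∑ᶜ j g
  ∑ᶜ-mono j f≤g = ∑ₛ-mono (λ A → cls-mono j A (f≤g A))

  ∑ᶜ-+ : ∀ j f g → ∑ᶜ j (λ A → f A + g A) ≡ ∑ᶜ j f + ∑ᶜ j g
  ∑ᶜ-+ j f g = trans (∑ₛ-cong (λ A → *-distribˡ-+ (cls j A) (f A) (g A))) (∑ₛ-+ (λ A → cls j A * f A) (λ A → cls j A * g A))

  ∑ᶜ-* : ∀ j c f → ∑ᶜ j (λ A → c * f A) ≡ c * ∑ᶜ j f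
  ∑ᶜ-* j c f = trans (∑ₛ-cong (λ A → *-swap (cls j A) c (f A))) (∑ₛ-* c (λ A → cls j A * f A))

  ∑ᶜ-const : ∀ j c → ∑ᶜ j (λ _ → c) ≡ c * count j
  ∑ᶜ-const j c = trans (∑ₛ-cong (λ A → cong (cls j A *_) (sym (*-identityʳ c)))) (∑ᶜ-* j c (λ _ → 1))

  cls-─ : ∀ m A {x} → lookup A x ≡ true → deg G A x ≡ 0 → cls m (A ─ x) ≡ cls (suc m) A
  cls-─ m A {x} x∈A d≡0 = cong₂ _*_ (cong (λ t → δ t (suc m)) (sym (∣∣-─ A x∈A)))
    (cong₂ (λ a b → δ a v * δ b s) (nonisolated-─-isolated G A x∈A d≡0)
      (sym (trans (degreeSum-─ G A x∈A) (trans (cong (λ d → degreeSum G (A ─ x) + (d + d)) d≡0) (+-identityʳ _)))))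

  isoSum : Subset n → (Fin n → ℕ) → ℕ
  isoSum A f = sum (λ x → el A x * nul (deg G A x) * f x)

  -- Double counting of the pairs with A = B + x and x isolated in A: seen from B, x is any vertex
  -- outside N[B]; seen from A, it is any isolated vertex. `cls-─` keeps both sets in the same
  -- class.
  transfer : ∀ m (g : Subset n → ℕ) →
    ∑ᶜ m (λ B → nonneighbours G B * g B) ≡ ∑ᶜ (suc m) (λ A → isoSum A (λ x → g (A ─ x)))
  transfer m g = begin
    ∑ₛ (λ B → cls m B * (nonneighbours G B * g B))
      ≡⟨ ∑ₛ-cong expand ⟩
    ∑ₛ (λ B → sum (λ x → 𝟙 (not (lookup B x)) * H B x))
      ≡⟨ ∑ₛ-delete H ⟩
    ∑ₛ (λ A → sum (λ x → 𝟙 (lookup A x) * H (A ─ x) x))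
      ≡⟨ ∑ₛ-cong (λ A → sum-cong-≗ (move A)) ⟩
    ∑ₛ (λ A → sum (λ x → cls (suc m) A * (el A x * nul (deg G A x) * g (A ─ x))))
      ≡⟨ ∑ₛ-cong (λ A → *-distribˡ-sum (cls (suc m) A) (λ x → el A x * nul (deg G A x) * g (A ─ x))) ⟨
    ∑ₛ (λ A → cls (suc m) A * isoSum A (λ x → g (A ─ x))) ∎
    where
    open ≡-Reasoning
    H : Subset n → Fin n → ℕ
    H B x = nul (deg G B x) * (cls m B * g B)
    shuffle : ∀ a b c d → a * (b * (c * d)) ≡ c * (a * b * d)
    shuffle = solve-∀
    expand : ∀ B → cls m B * (nonneighbours G B * g B) ≡ sum (λ x → 𝟙 (not (lookup B x)) * H B x)
    expand B = begin
      cls m B * (nonneighbours G B * g B)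
        ≡⟨ *-swap (cls m B) (nonneighbours G B) (g B) ⟩
      nonneighbours G B * (cls m B * g B)
        ≡⟨ *-distribʳ-sum (cls m B * g B) (λ x → 𝟙 (not (lookup B x)) * nul (deg G B x)) ⟩
      sum (λ x → 𝟙 (not (lookup B x)) * nul (deg G B x) * (cls m B * g B))
        ≡⟨ sum-cong-≗ (λ x → *-assoc (𝟙 (not (lookup B x))) (nul (deg G B x)) _) ⟩
      sum (λ x → 𝟙 (not (lookup B x)) * H B x) ∎
    move : ∀ A x → 𝟙 (lookup A x) * H (A ─ x) x ≡ cls (suc m) A * (el A x * nul (deg G A x) * g (A ─ x))
    move A x with lookup A x in eq
    ... | false = sym (*-zeroʳ (cls (suc m) A))
    -- There are no loops, so x has the same degree into A and into A ─ x; unless it is 0, both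
    -- sides vanish.
    ... | true rewrite sym (deg-─-self G A eq) with deg G A x in d
    ...   | suc _ = sym (*-zeroʳ (cls (suc m) A))
    ...   | zero rewrite cls-─ m A eq d = shuffle 1 1 (cls (suc m) A) (g (A ─ x))

  isoSum-const : ∀ A c → isoSum A (λ _ → c) ≡ isolated G A * c
  isoSum-const A c = sym (*-distribʳ-sum c (λ x → el A x * nul (deg G A x)))

  isoSum-mono : ∀ A {f g} → (∀ x → f x ≤ g x) → isoSum A f ≤ isoSum A g
  isoSum-mono A f≤g = sum-mono (λ x → *-monoʳ-≤ (el A x * nul (deg G A x)) (f≤g x))

  isoSum-+ : ∀ A f g → isoSum A (λ x → f x + g x) ≡ isoSum A f + isoSum A g
  isoSum-+ A f g = trans (sum-cong-≗ (λ x → *-distribˡ-+ (el A x * nul (deg G A x)) (f x) (g x))) (∑-distrib-+ (λ x → el A x * nul (deg G A x) * f x) (λ x → el A x * nul (deg G A x) * g x))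

  isolated≡ : ∀ A {j} → ∣ A ∣ ≡ j → nonisolated G A ≡ v → isolated G A ≡ j ∸ v
  isolated≡ A refl refl = trans (sym (m+n∸n≡m (isolated G A) (nonisolated G A))) (cong (_∸ nonisolated G A) (isolated+nonisolated G A))

  module Flow (c lo D : ℕ) where
    open Cutoff lo D public

    q : Subset n → ℕ
    q A = c * coverage G A

    low high : ℕ → ℕ
    low  j = ∑ᶜ j (below ∘ q)
    high j = ∑ᶜ j (above ∘ q)

    low+high : ∀ j → low j + high j ≡ D * count j
    low+high j = trans (sym (∑ᶜ-+ j (below ∘ q) (above ∘ q))) (trans (∑ₛ-cong (λ A → cong (cls j A *_) (below+above (q A)))) (∑ᶜ-const j D))

    low≤ : ∀ j → low j ≤ D * count j
    low≤ j = ≤-trans (m≤m+n (low j) (high j)) (≤-reflexive (low+high j))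

    high≤ : ∀ j → high j ≤ D * count j
    high≤ j = ≤-trans (m≤n+m (high j) (low j)) (≤-reflexive (low+high j))

    lossₕ : Subset n → Fin n → ℕ
    lossₕ A x = c * loss G A x ∸ (q A ∸ hi)

    q-─ : ∀ A x → q A ≤ q (A ─ x) + c * loss G A x
    q-─ A x = ≤-trans (*-monoʳ-≤ c (coverage-─ G A x)) (≤-reflexive (*-distribˡ-+ c _ _))

    -- Before truncation the losses add up to at most q A. By `sum-∸`, truncating every term is at
    -- least as strong as truncating the sum once, which leaves q A ∸ (q A ∸ hi) ≤ hi.
    isoSum-loss : ∀ A → isoSum A (lossₕ A) ≤ hi
    isoSum-loss A = begin
      isoSum A (lossₕ A)
        ≤⟨ sum-mono pointwise ⟩
      sum (λ x → c * (el A x * loss G A x) ∸ d)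
        ≤⟨ sum-∸ (λ x → c * (el A x * loss G A x)) d ⟩
      sum (λ x → c * (el A x * loss G A x)) ∸ d
        ≡⟨ cong (_∸ d) (*-distribˡ-sum c (λ x → el A x * loss G A x)) ⟨
      c * sum (λ x → el A x * loss G A x) ∸ d
        ≤⟨ ∸-monoˡ-≤ d (*-monoʳ-≤ c (sum-loss≤coverage G A)) ⟩
      q A ∸ d
        ≤⟨ m≤n+o⇒m∸n≤o (q A) d (≤-trans (m≤n+m∸n (q A) hi) (≤-reflexive (+-comm hi d))) ⟩
      hi ∎
      where
      open ≤-Reasoning
      d = q A ∸ hi
      nul≤1 : ∀ m → nul m ≤ 1
      nul≤1 zero    = ≤-refl
      nul≤1 (suc _) = z≤n
      pointwise : ∀ x → el A x * nul (deg G A x) * lossₕ A x ≤ c * (el A x * loss G A x) ∸ d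
      pointwise x with lookup A x
      ... | false = z≤n
      ... | true  = begin
        1 * nul (deg G A x) * lossₕ A x   ≤⟨ *-monoˡ-≤ (lossₕ A x) (≤-trans (≤-reflexive (+-identityʳ _)) (nul≤1 (deg G A x))) ⟩
        1 * lossₕ A x                     ≡⟨ +-identityʳ _ ⟩
        c * loss G A x ∸ d                ≡⟨ cong (λ t → c * t ∸ d) (+-identityʳ (loss G A x)) ⟨
        c * (1 * loss G A x) ∸ d          ∎

    split-n : ∀ A h → c * n * h ≡ c * (nonneighbours G A * h) + q A * h
    split-n A h = trans (cong (λ t → c * t * h) (sym (nonneighbours+coverage G A))) (shuffle c (nonneighbours G A) (coverage G A) h)
      where
      shuffle : ∀ c a b h → c * (a + b) * h ≡ c * (a * h) + c * b * h
      shuffle = solve-∀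

    -- On the support of `below`, c |N[B]| ≤ hi, so at least n - hi/c vertices can be added to B as
    -- isolated ones. At level m + 1 each A is reached from its m + 1 - v isolated vertices, and
    -- replacing `below (q (A ─ x))` by `below (q A)` costs at most `hi` per set A.
    low-step : ∀ m → c * n * low m ≤ hi * low m + c * ((suc m ∸ v) * low (suc m) + hi * count (suc m))
    low-step m = begin
      c * n * low m
        ≡⟨ ∑ᶜ-* m (c * n) (below ∘ q) ⟨
      ∑ᶜ m (λ B → c * n * below (q B))
        ≤⟨ ∑ᶜ-mono m (λ B _ _ → ≤-trans (≤-reflexive (trans (split-n B (below (q B))) (+-comm (c * _) _))) (+-monoˡ-≤ _ (below-support (q B)))) ⟩
      ∑ᶜ m (λ B → hi * below (q B) + c * (nonneighbours G B * below (q B)))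
        ≡⟨ trans (∑ᶜ-+ m _ _) (cong₂ _+_ (∑ᶜ-* m hi (below ∘ q)) (∑ᶜ-* m c (λ B → nonneighbours G B * below (q B)))) ⟩
      hi * low m + c * ∑ᶜ m (λ B → nonneighbours G B * below (q B))
        ≡⟨ cong (λ t → hi * low m + c * t) (transfer m (below ∘ q)) ⟩
      hi * low m + c * ∑ᶜ (suc m) (λ A → isoSum A (λ x → below (q (A ─ x))))
        ≤⟨ +-monoʳ-≤ (hi * low m) (*-monoʳ-≤ c (∑ᶜ-mono (suc m) gain)) ⟩
      hi * low m + c * ∑ᶜ (suc m) (λ A → (suc m ∸ v) * below (q A) + hi)
        ≡⟨ cong (λ t → hi * low m + c * t) (trans (∑ᶜ-+ (suc m) _ _) (cong₂ _+_ (∑ᶜ-* (suc m) (suc m ∸ v) (below ∘ q)) (∑ᶜ-const (suc m) hi))) ⟩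
      hi * low m + c * ((suc m ∸ v) * low (suc m) + hi * count (suc m)) ∎
      where
      open ≤-Reasoning
      gain : ∀ A → ∣ A ∣ ≡ suc m → nonisolated G A ≡ v → isoSum A (λ x → below (q (A ─ x))) ≤ (suc m ∸ v) * below (q A) + hi
      gain A size ν = begin
        isoSum A (λ x → below (q (A ─ x)))
          ≤⟨ isoSum-mono A (λ x → below-loss (q A) (q (A ─ x)) (c * loss G A x) (q-─ A x)) ⟩
        isoSum A (λ x → below (q A) + lossₕ A x)
          ≡⟨ isoSum-+ A (λ _ → below (q A)) (lossₕ A) ⟩
        isoSum A (λ _ → below (q A)) + isoSum A (lossₕ A)
          ≤⟨ +-mono-≤ (≤-reflexive (trans (isoSum-const A (below (q A))) (cong (_* below (q A)) (isolated≡ A size ν)))) (isoSum-loss A) ⟩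
        (suc m ∸ v) * below (q A) + hi ∎

    -- The mirror image: on the support of `above`, c |N[B]| ≥ lo, so at most n - lo/c vertices can
    -- be added, while every A at level m + 1 has m + 1 - v isolated vertices to delete.
    high-step : ∀ m → c * ((suc m ∸ v) * high (suc m)) + lo * high m ≤ c * n * high m + c * (hi * count (suc m))
    high-step m = begin
      c * ((suc m ∸ v) * high (suc m)) + lo * high m
        ≡⟨ cong (λ t → c * t + lo * high m) (∑ᶜ-* (suc m) (suc m ∸ v) (above ∘ q)) ⟨
      c * ∑ᶜ (suc m) (λ A → (suc m ∸ v) * above (q A)) + lo * high m
        ≤⟨ +-monoˡ-≤ _ (*-monoʳ-≤ c (∑ᶜ-mono (suc m) drop)) ⟩
      c * ∑ᶜ (suc m) (λ A → isoSum A (λ x → above (q (A ─ x))) + hi) + lo * high m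
        ≡⟨ cong (λ t → c * t + lo * high m) (trans (∑ᶜ-+ (suc m) _ _) (cong₂ _+_ (sym (transfer m (above ∘ q))) (∑ᶜ-const (suc m) hi))) ⟩
      c * (∑ᶜ m (λ B → nonneighbours G B * above (q B)) + hi * count (suc m)) + lo * high m
        ≡⟨ shuffle c (∑ᶜ m (λ B → nonneighbours G B * above (q B))) (hi * count (suc m)) (lo * high m) ⟩
      (c * ∑ᶜ m (λ B → nonneighbours G B * above (q B)) + lo * high m) + c * (hi * count (suc m))
        ≡⟨ cong (_+ c * (hi * count (suc m))) (trans (∑ᶜ-+ m _ _) (cong₂ _+_ (∑ᶜ-* m c (λ B → nonneighbours G B * above (q B))) (∑ᶜ-* m lo (above ∘ q)))) ⟨
      ∑ᶜ m (λ B → c * (nonneighbours G B * above (q B)) + lo * above (q B)) + c * (hi * count (suc m))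
        ≤⟨ +-monoˡ-≤ _ (∑ᶜ-mono m (λ B _ _ → ≤-trans (+-monoʳ-≤ (c * _) (above-support (q B))) (≤-reflexive (sym (split-n B (above (q B))))))) ⟩
      ∑ᶜ m (λ B → c * n * above (q B)) + c * (hi * count (suc m))
        ≡⟨ cong (_+ c * (hi * count (suc m))) (∑ᶜ-* m (c * n) (above ∘ q)) ⟩
      c * n * high m + c * (hi * count (suc m)) ∎
      where
      open ≤-Reasoning
      shuffle : ∀ c a b d → c * (a + b) + d ≡ (c * a + d) + c * b
      shuffle = solve-∀
      drop : ∀ A → ∣ A ∣ ≡ suc m → nonisolated G A ≡ v → (suc m ∸ v) * above (q A) ≤ isoSum A (λ x → above (q (A ─ x))) + hi
      drop A size ν = begin
        (suc m ∸ v) * above (q A)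
          ≡⟨ trans (isoSum-const A (above (q A))) (cong (_* above (q A)) (isolated≡ A size ν)) ⟨
        isoSum A (λ _ → above (q A))
          ≤⟨ isoSum-mono A (λ x → above-loss (q A) (q (A ─ x)) (c * loss G A x) (q-─ A x)) ⟩
        isoSum A (λ x → above (q (A ─ x)) + lossₕ A x)
          ≡⟨ isoSum-+ A (λ x → above (q (A ─ x))) (lossₕ A) ⟩
        isoSum A (λ x → above (q (A ─ x))) + isoSum A (lossₕ A)
          ≤⟨ +-monoʳ-≤ _ (isoSum-loss A) ⟩
        isoSum A (λ x → above (q (A ─ x))) + hi ∎

-- Spreading over a window of levels

∑< : ℕ → (ℕ → ℕ) → ℕ
∑< zero    f = 0
∑< (suc t) f = ∑< t f + f t

∑<-mono : ∀ t {f g} → (∀ i → i < t → f i ≤ g i) → ∑< t f ≤ ∑< t g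
∑<-mono zero    f≤g = z≤n
∑<-mono (suc t) f≤g = +-mono-≤ (∑<-mono t (λ i i<t → f≤g i (m<n⇒m<1+n i<t))) (f≤g t ≤-refl)

∑<-+ : ∀ t f g → ∑< t (λ i → f i + g i) ≡ ∑< t f + ∑< t g
∑<-+ zero    f g = refl
∑<-+ (suc t) f g = trans (cong (_+ (f t + g t)) (∑<-+ t f g)) (interchange (∑< t f) _ _ _)

∑<-* : ∀ t c f → ∑< t (λ i → c * f i) ≡ c * ∑< t f
∑<-* zero    c f = sym (*-zeroʳ c)
∑<-* (suc t) c f = trans (cong (_+ c * f t) (∑<-* t c f)) (sym (*-distribˡ-+ c (∑< t f) (f t)))

∑<-const : ∀ t c → ∑< t (λ _ → c) ≡ t * c
∑<-const zero    c = refl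
∑<-const (suc t) c = trans (cong (_+ c) (∑<-const t c)) (+-comm (t * c) c)

∑<-append : ∀ s t f → ∑< (s + t) f ≡ ∑< s f + ∑< t (f ∘ (s +_))
∑<-append s zero    f = trans (cong (λ t → ∑< t f) (+-identityʳ s)) (sym (+-identityʳ _))
∑<-append s (suc t) f = begin
  ∑< (s + suc t) f                               ≡⟨ cong (λ t → ∑< t f) (+-suc s t) ⟩
  ∑< (s + t) f + f (s + t)                       ≡⟨ cong (_+ f (s + t)) (∑<-append s t f) ⟩
  ∑< s f + ∑< t (f ∘ (s +_)) + f (s + t)         ≡⟨ +-assoc (∑< s f) _ _ ⟩
  ∑< s f + (∑< t (f ∘ (s +_)) + f (s + t))       ∎
  where open ≡-Reasoning

∑<-cong : ∀ t {f g} → (∀ i → f i ≡ g i) → ∑< t f ≡ ∑< t g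
∑<-cong zero    f≡g = refl
∑<-cong (suc t) f≡g = cong₂ _+_ (∑<-cong t f≡g) (f≡g t)

∑<-≤-∑< : ∀ {s t} f → s ≤ t → ∑< s f ≤ ∑< t f
∑<-≤-∑< {s} f s≤t = subst (λ t → ∑< s f ≤ ∑< t f) (m+[n∸m]≡n s≤t)
  (≤-trans (m≤m+n _ _) (≤-reflexive (sym (∑<-append s _ f))))

module Telescope (p : ℕ → ℕ) (α β a : ℕ) where

  -- Bounds the errors of e steps from level a on: each p (a + i) occurs at most once with α and
  -- once with β, and the last one only with β.
  bound : ℕ → ℕ
  bound e = (α + β) * ∑< e (p ∘ (a +_)) + β * p (a + e)

  private
    advance : ∀ e → bound e + (α * p (a + e) + β * p (suc (a + e))) ≡ bound (suc e)
    advance e = trans (ring α β (∑< e (p ∘ (a +_))) (p (a + e)) (p (suc (a + e))))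
      (cong (λ t → (α + β) * ∑< (suc e) (p ∘ (a +_)) + β * p t) (sym (+-suc a e)))
      where
      ring : ∀ α β S x y → (α + β) * S + β * x + (α * x + β * y) ≡ (α + β) * (S + x) + β * y
      ring = solve-∀

  bound≤ : ∀ e → bound e ≤ (α + β) * ∑< (suc e) (p ∘ (a +_))
  bound≤ e = ≤-trans
    (+-monoʳ-≤ ((α + β) * ∑< e (p ∘ (a +_))) (*-monoˡ-≤ (p (a + e)) (m≤n+m β α)))
    (≤-reflexive (sym (*-distribˡ-+ (α + β) (∑< e (p ∘ (a +_))) _)))

  up : ∀ φ e → (∀ i → i < e → φ (a + i) ≤ φ (suc (a + i)) + (α * p (a + i) + β * p (suc (a + i)))) →
    φ a ≤ φ (a + e) + bound e
  up φ zero    _    = ≤-trans (≤-reflexive (cong φ (sym (+-identityʳ a)))) (m≤m+n _ _)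
  up φ (suc e) step = begin
    φ a
      ≤⟨ up φ e (λ i i<e → step i (m<n⇒m<1+n i<e)) ⟩
    φ (a + e) + bound e
      ≤⟨ +-monoˡ-≤ _ (step e ≤-refl) ⟩
    φ (suc (a + e)) + (α * p (a + e) + β * p (suc (a + e))) + bound e
      ≡⟨ trans (+-assoc (φ (suc (a + e))) _ _) (cong (φ (suc (a + e)) +_) (trans (+-comm _ (bound e)) (advance e))) ⟩
    φ (suc (a + e)) + bound (suc e)
      ≡⟨ cong (λ t → φ t + bound (suc e)) (+-suc a e) ⟨
    φ (a + suc e) + bound (suc e) ∎
    where open ≤-Reasoning

  down : ∀ φ e → (∀ i → i < e → φ (suc (a + i)) ≤ φ (a + i) + (α * p (a + i) + β * p (suc (a + i)))) →
    φ (a + e) ≤ φ a + bound e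
  down φ zero    _    = ≤-trans (≤-reflexive (cong φ (+-identityʳ a))) (m≤m+n _ _)
  down φ (suc e) step = begin
    φ (a + suc e)
      ≡⟨ cong φ (+-suc a e) ⟩
    φ (suc (a + e))
      ≤⟨ step e ≤-refl ⟩
    φ (a + e) + (α * p (a + e) + β * p (suc (a + e)))
      ≤⟨ +-monoˡ-≤ _ (down φ e (λ i i<e → step i (m<n⇒m<1+n i<e))) ⟩
    φ a + bound e + (α * p (a + e) + β * p (suc (a + e)))
      ≡⟨ trans (+-assoc (φ a) _ _) (cong (φ a +_) (advance e)) ⟩
    φ a + bound (suc e) ∎
    where open ≤-Reasoning

-- The coefficient ι = m + 1 - v varies with the level, which would obstruct telescoping. Comparing
-- only the excess x ∸ y replaces it by the fixed k, at the price of a factor 2 on the error.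
double-slack : ∀ {k ι} x y E → k ≤ 2 * ι → ι * x ≤ ι * y + E → k * x ≤ k * y + 2 * E
double-slack {k} {ι} x y E k≤2ι le with ≤-total x y
... | inj₁ x≤y = ≤-trans (*-monoʳ-≤ k x≤y) (m≤m+n _ _)
... | inj₂ y≤x = begin
  k * x                    ≡⟨ cong (k *_) (m+[n∸m]≡n y≤x) ⟨
  k * (y + t)              ≡⟨ *-distribˡ-+ k y t ⟩
  k * y + k * t            ≤⟨ +-monoʳ-≤ (k * y) (*-monoˡ-≤ t k≤2ι) ⟩
  k * y + 2 * ι * t        ≡⟨ cong (k * y +_) (*-assoc 2 ι t) ⟩
  k * y + 2 * (ι * t)      ≤⟨ +-monoʳ-≤ (k * y) (*-monoʳ-≤ 2 (+-cancelˡ-≤ (ι * y) _ _ (≤-trans (≤-reflexive (trans (sym (*-distribˡ-+ ι y t)) (cong (ι *_) (m+[n∸m]≡n y≤x)))) le))) ⟩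
  k * y + 2 * E            ∎
  where
  open ≤-Reasoning
  t = x ∸ y

module StepArithmetic (n k r v ι : ℕ) (p q : ℕ) (1≤k : 1 ≤ k) (v≤R² : v ≤ suc r * suc r) (k≤2ι : k ≤ 2 * ι) where

  private
    R = suc r
    c = k * R
    N = n * v
    -- The error of one step: 6 = 3 · 2 comes from the deviation 3k and the cutoff height 2N, with v
    -- ≤ R² turning v/R into R; the 2 comes from 2 + r ≤ 2R.
    E = N * (6 * R * p + 2 * R * q)

  relax : ∀ x y z → z ≤ 2 * N * p →
    c * (ι * x) ≤ c * (ι * y) + (3 * k * v * z + c * (N * (2 + r) * q)) →
    k * x ≤ k * y + 2 * E
  relax x y z z≤ le = double-slack {k} {ι} x y E k≤2ι (*-cancelˡ-≤ c ⦃ m*n≢0 k R ⦃ >-nonZero 1≤k ⦄ ⦄ (begin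
    c * (ι * x)
      ≤⟨ le ⟩
    c * (ι * y) + (3 * k * v * z + c * (N * (2 + r) * q))
      ≤⟨ +-monoʳ-≤ (c * (ι * y)) (+-mono-≤ first second) ⟩
    c * (ι * y) + (3 * k * (R * R) * (2 * N * p) + c * (N * (2 * R) * q))
      ≡⟨ collect k R (ι * y) N p q ⟩
    c * (ι * y + E) ∎))
    where
    open ≤-Reasoning
    first : 3 * k * v * z ≤ 3 * k * (R * R) * (2 * N * p)
    first = *-mono-≤ (*-monoʳ-≤ (3 * k) v≤R²) z≤
    second : c * (N * (2 + r) * q) ≤ c * (N * (2 * R) * q)
    second = *-monoʳ-≤ c (*-monoˡ-≤ q (*-monoʳ-≤ N (≤-trans (+-monoʳ-≤ 2 (m≤m*n r 2)) (≤-reflexive (ring r)))))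
      where
      ring : ∀ r → 2 + r * 2 ≡ 2 * (1 + r)
      ring = solve-∀
    collect : ∀ k R y N p q → k * R * y + (3 * k * (R * R) * (2 * N * p) + k * R * (N * (2 * R) * q)) ≡ k * R * (y + N * (6 * R * p + 2 * R * q))
    collect = solve-∀

  -- With ι + v = m + 1, the left side exceeds c ι x by v c x. This cancels against the term of `hi`
  -- up to 3kvx, because (R + 1)(m + 1) is at most kR + 3k throughout the window.
  up : ∀ x y → x ≤ 2 * N * p → (2 + r) * (ι + v) ≤ k * R + 3 * k →
    c * ((ι + v) * x) ≤ v * (2 + r) * ((ι + v) * x) + c * (ι * y + N * (2 + r) * q) →
    k * x ≤ k * y + 2 * E
  up x y x≤ M≤ le = relax x y x x≤ (+-cancelʳ-≤ (v * c * x) _ _ (begin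
    c * (ι * x) + v * c * x
      ≡⟨ r1 c ι v x ⟩
    c * ((ι + v) * x)
      ≤⟨ le ⟩
    v * (2 + r) * ((ι + v) * x) + c * (ι * y + N * (2 + r) * q)
      ≡⟨ r2 v (2 + r) (ι + v) x c (ι * y) (N * (2 + r) * q) ⟩
    v * ((2 + r) * (ι + v)) * x + (c * (ι * y) + c * (N * (2 + r) * q))
      ≤⟨ +-monoˡ-≤ _ (*-monoˡ-≤ x (*-monoʳ-≤ v M≤)) ⟩
    v * (c + 3 * k) * x + (c * (ι * y) + c * (N * (2 + r) * q))
      ≡⟨ r3 v c k x (c * (ι * y)) (c * (N * (2 + r) * q)) ⟩
    c * (ι * y) + (3 * k * v * x + c * (N * (2 + r) * q)) + v * c * x ∎))
    where
    open ≤-Reasoning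
    r1 : ∀ c ι v x → c * (ι * x) + v * c * x ≡ c * ((ι + v) * x)
    r1 = solve-∀
    r2 : ∀ v R M x c y z → v * R * (M * x) + c * (y + z) ≡ v * (R * M) * x + (c * y + c * z)
    r2 = solve-∀
    r3 : ∀ v c k x y z → v * (c + 3 * k) * x + (y + z) ≡ y + (3 * k * v * x + z) + v * c * x
    r3 = solve-∀

  -- Here r (m + 1) is at least kR - 3k, so the term of `lo` absorbs v c y in the same way.
  down : ∀ x y → y ≤ 2 * N * p → k * R ≤ r * (ι + v) + 3 * k →
    c * (ι * x) + v * r * ((ι + v) * y) ≤ c * ((ι + v) * y) + c * (N * (2 + r) * q) →
    k * x ≤ k * y + 2 * E
  down x y y≤ kR≤ le = relax x y y y≤ (+-cancelʳ-≤ (v * r * ((ι + v) * y)) _ _ (begin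
    c * (ι * x) + v * r * ((ι + v) * y)
      ≤⟨ le ⟩
    c * ((ι + v) * y) + c * (N * (2 + r) * q)
      ≡⟨ r1 c ι v y (c * (N * (2 + r) * q)) ⟩
    c * (ι * y) + v * c * y + c * (N * (2 + r) * q)
      ≤⟨ +-monoˡ-≤ _ (+-monoʳ-≤ (c * (ι * y)) (*-monoˡ-≤ y (*-monoʳ-≤ v kR≤))) ⟩
    c * (ι * y) + v * (r * (ι + v) + 3 * k) * y + c * (N * (2 + r) * q)
      ≡⟨ r2 (c * (ι * y)) v r (ι + v) k y (c * (N * (2 + r) * q)) ⟩
    c * (ι * y) + (3 * k * v * y + c * (N * (2 + r) * q)) + v * r * ((ι + v) * y) ∎))
    where
    open ≤-Reasoning
    r1 : ∀ c ι v y z → c * ((ι + v) * y) + z ≡ c * (ι * y) + v * c * y + z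
    r1 = solve-∀
    r2 : ∀ a v r M k y z → a + v * (r * M + 3 * k) * y + z ≡ a + (3 * k * v * y + z) + v * r * (M * y)
    r2 = solve-∀

-- n ^ (L ∸ j) * j ! turns counts of j-sets into counts of sequences of length L.
weight : ℕ → ℕ → ℕ → ℕ
weight n L j = j ! * n ^ (L ∸ j)

-- Passing from m to m + 1 trades a factor n for m + 1; V is what both weights share.
weight-step : ∀ n {L m} → m < L → ∃ λ V → weight n L m ≡ n * V × weight n L (suc m) ≡ suc m * V
weight-step n {L} {m} m<L = m ! * n ^ (L ∸ suc m) ,
  trans (cong (λ t → m ! * n ^ t) (+-∸-assoc 1 {L} {suc m} m<L)) (*-swap (m !) n (n ^ (L ∸ suc m))) ,
  *-assoc (suc m) (m !) (n ^ (L ∸ suc m))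

-- The levels from k₀ to k and from k to k + w surround the level k = k₀ + w of interest. `uR≤k`
-- makes each half at most k/R levels wide, and `k₀-large` makes k ≤ 2(m + 1 - v) for every m ≥ k₀,
-- as `double-slack` requires.
module Window {n : ℕ} (G : Graph n) (s v : ℕ) (k₀ w r : ℕ)
  (1≤v : 1 ≤ v) (1≤n : 1 ≤ n) (v≤R² : v ≤ suc r * suc r)
  (uR≤k : suc w * suc r ≤ k₀ + w) (k₀-large : w + 2 * v ≤ k₀) where

  open Levels G s v

  private
    k = k₀ + w
    L = k + w
    R = suc r
    c = k * R
    N = n * v
    D = 2 * N

  -- Divided by c n, the ends of the cutoff are (1 ± 1/R) v/k.
  open Flow c (N * r) D

  private
    hi≡ : hi ≡ N * (2 + r)
    hi≡ = ring N r
      where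
      ring : ∀ N r → N * r + 2 * N ≡ N * (2 + r)
      ring = solve-∀

    1≤k : 1 ≤ k
    1≤k = ≤-trans (s≤s z≤n) uR≤k

    W : ℕ → ℕ
    W = weight n L

  -- For j ≤ L this is n^L p_j: it counts the sequences of length L whose first j entries are
  -- distinct and form a set of the class.
  mass : ℕ → ℕ
  mass j = W j * count j

  private
    scale : ∀ j {S} → S ≤ D * count j → W j * S ≤ 2 * N * mass j
    scale j S≤ = ≤-trans (*-monoʳ-≤ (W j) S≤) (≤-reflexive (*-swap (W j) D (count j)))

    module _ (m : ℕ) (k₀≤m : k₀ ≤ m) where
      ι = suc m ∸ v

      M≡ : ι + v ≡ suc m
      M≡ = m∸n+n≡m (≤-trans (m≤n*m v 2) (≤-trans (m≤n+m _ w) (≤-trans k₀-large (≤-trans k₀≤m (n≤1+n m)))))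

      k≤2ι : k ≤ 2 * ι
      k≤2ι = +-cancelʳ-≤ (2 * v) _ _ (begin
        k₀ + w + 2 * v      ≡⟨ +-assoc k₀ w _ ⟩
        k₀ + (w + 2 * v)    ≤⟨ +-monoʳ-≤ k₀ k₀-large ⟩
        k₀ + k₀             ≡⟨ cong (k₀ +_) (+-identityʳ k₀) ⟨
        2 * k₀              ≤⟨ *-monoʳ-≤ 2 (≤-trans k₀≤m (n≤1+n m)) ⟩
        2 * suc m           ≡⟨ cong (2 *_) M≡ ⟨
        2 * (ι + v)         ≡⟨ *-distribˡ-+ 2 ι v ⟩
        2 * ι + 2 * v       ∎)
        where open ≤-Reasoning

    wR≤k : w * R ≤ k
    wR≤k = ≤-trans (*-monoˡ-≤ R (n≤1+n w)) uR≤k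

    w≤k : w ≤ k
    w≤k = m≤n+m w k₀

    bound : ℕ → ℕ
    bound m = 2 * (N * (6 * R * mass m + 2 * R * mass (suc m)))

  low-scaled : ∀ m → k₀ ≤ m → m < L → k * (W m * low m) ≤ k * (W (suc m) * low (suc m)) + bound m
  low-scaled m k₀≤m m<L with weight-step n {L} {m} m<L
  -- `low-step` is scaled by (m + 1) V: then n V becomes `W m` at level m, and (m + 1) V becomes
  -- `W (suc m)` at level m + 1.
  ... | V , Wm≡ , WM≡ = A.up (W m * low m) (W (suc m) * low (suc m)) (scale m (low≤ m)) M≤ (begin
    c * ((i + v) * (W m * low m))
      ≡⟨ cong₂ (λ a b → c * (a * (b * low m))) (M≡ m k₀≤m) Wm≡ ⟩
    c * (suc m * (n * V * low m))
      ≡⟨ r1 c (suc m) n V (low m) ⟩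
    suc m * V * (c * n * low m)
      ≤⟨ *-monoʳ-≤ (suc m * V) (low-step m) ⟩
    suc m * V * (hi * low m + c * (i * low (suc m) + hi * count (suc m)))
      ≡⟨ cong (λ h → suc m * V * (h * low m + c * (i * low (suc m) + h * count (suc m)))) hi≡ ⟩
    suc m * V * (N * (2 + r) * low m + c * (i * low (suc m) + N * (2 + r) * count (suc m)))
      ≡⟨ r2 (suc m) V n v (2 + r) (low m) c i (low (suc m)) (count (suc m)) ⟩
    v * (2 + r) * (suc m * (n * V * low m)) + c * (i * (suc m * V * low (suc m)) + N * (2 + r) * (suc m * V * count (suc m)))
      ≡⟨ cong₂ (λ a b → v * (2 + r) * (a * (b * low m)) + c * (i * (suc m * V * low (suc m)) + N * (2 + r) * (suc m * V * count (suc m)))) (M≡ m k₀≤m) Wm≡ ⟨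
    v * (2 + r) * ((i + v) * (W m * low m)) + c * (i * (suc m * V * low (suc m)) + N * (2 + r) * (suc m * V * count (suc m)))
      ≡⟨ cong (λ a → v * (2 + r) * ((i + v) * (W m * low m)) + c * (i * (a * low (suc m)) + N * (2 + r) * (a * count (suc m)))) WM≡ ⟨
    v * (2 + r) * ((i + v) * (W m * low m)) + c * (i * (W (suc m) * low (suc m)) + N * (2 + r) * mass (suc m)) ∎)
    where
    open ≤-Reasoning
    i = suc m ∸ v
    module A = StepArithmetic n k r v i (mass m) (mass (suc m)) 1≤k v≤R² (k≤2ι m k₀≤m)
    r1 : ∀ c M n V x → c * (M * (n * V * x)) ≡ M * V * (c * n * x)
    r1 = solve-∀
    r2 : ∀ M V n v R x c i y z → M * V * (n * v * R * x + c * (i * y + n * v * R * z)) ≡ v * R * (M * (n * V * x)) + c * (i * (M * V * y) + n * v * R * (M * V * z))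
    r2 = solve-∀
    -- m + 1 ≤ k + w, and in (R + 1)(k + w) = kR + k + wR + w each of the last three terms is at
    -- most k.
    M≤ : (2 + r) * (i + v) ≤ k * R + 3 * k
    M≤ = begin
      (2 + r) * (i + v)           ≡⟨ cong ((2 + r) *_) (M≡ m k₀≤m) ⟩
      (2 + r) * suc m             ≤⟨ *-monoʳ-≤ (2 + r) m<L ⟩
      (2 + r) * (k + w)           ≡⟨ r3 r k w ⟩
      k * R + (k + w * R + w)     ≤⟨ +-monoʳ-≤ (k * R) (+-mono-≤ (+-monoʳ-≤ k wR≤k) w≤k) ⟩
      k * R + (k + k + k)         ≡⟨ r4 (k * R) k ⟩
      k * R + 3 * k               ∎
      where
      r3 : ∀ r k w → (2 + r) * (k + w) ≡ k * (1 + r) + (k + w * (1 + r) + w)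
      r3 = solve-∀
      r4 : ∀ a k → a + (k + k + k) ≡ a + 3 * k
      r4 = solve-∀

  high-scaled : ∀ m → k₀ ≤ m → m < L → k * (W (suc m) * high (suc m)) ≤ k * (W m * high m) + bound m
  high-scaled m k₀≤m m<L with weight-step n {L} {m} m<L
  ... | V , Wm≡ , WM≡ = A.down (W (suc m) * high (suc m)) (W m * high m) (scale m (high≤ m)) kR≤ (begin
    c * (i * (W (suc m) * high (suc m))) + v * r * ((i + v) * (W m * high m))
      ≡⟨ cong₂ (λ a b → c * (i * (a * high (suc m))) + v * r * ((i + v) * (b * high m))) WM≡ Wm≡ ⟩
    c * (i * (suc m * V * high (suc m))) + v * r * ((i + v) * (n * V * high m))
      ≡⟨ cong (λ a → c * (i * (suc m * V * high (suc m))) + v * r * (a * (n * V * high m))) (M≡ m k₀≤m) ⟩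
    c * (i * (suc m * V * high (suc m))) + v * r * (suc m * (n * V * high m))
      ≡⟨ r1 c i (suc m) V (high (suc m)) v r n (high m) ⟩
    suc m * V * (c * (i * high (suc m)) + N * r * high m)
      ≤⟨ *-monoʳ-≤ (suc m * V) (high-step m) ⟩
    suc m * V * (c * n * high m + c * (hi * count (suc m)))
      ≡⟨ cong (λ h → suc m * V * (c * n * high m + c * (h * count (suc m)))) hi≡ ⟩
    suc m * V * (c * n * high m + c * (N * (2 + r) * count (suc m)))
      ≡⟨ r2 (suc m) V c n (high m) (N * (2 + r)) (count (suc m)) ⟩
    c * (suc m * (n * V * high m)) + c * (N * (2 + r) * (suc m * V * count (suc m)))
      ≡⟨ cong₂ (λ a b → c * (a * (b * high m)) + c * (N * (2 + r) * (suc m * V * count (suc m)))) (M≡ m k₀≤m) Wm≡ ⟨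
    c * ((i + v) * (W m * high m)) + c * (N * (2 + r) * (suc m * V * count (suc m)))
      ≡⟨ cong (λ a → c * ((i + v) * (W m * high m)) + c * (N * (2 + r) * (a * count (suc m)))) WM≡ ⟨
    c * ((i + v) * (W m * high m)) + c * (N * (2 + r) * mass (suc m)) ∎)
    where
    open ≤-Reasoning
    i = suc m ∸ v
    module A = StepArithmetic n k r v i (mass m) (mass (suc m)) 1≤k v≤R² (k≤2ι m k₀≤m)
    r1 : ∀ c i M V y v r n x → c * (i * (M * V * y)) + v * r * (M * (n * V * x)) ≡ M * V * (c * (i * y) + n * v * r * x)
    r1 = solve-∀
    r2 : ∀ M V c n x h z → M * V * (c * n * x + c * (h * z)) ≡ c * (M * (n * V * x)) + c * (h * (M * V * z))
    r2 = solve-∀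
    -- Here m + 1 ≥ k₀ = k - w, and 2k would do; the third k gives both directions the same
    -- constant.
    kR≤ : k * R ≤ r * (i + v) + 3 * k
    kR≤ = begin
      k * R                       ≡⟨ r3 k₀ w r ⟩
      k + (r * k₀ + w * r)        ≤⟨ +-monoʳ-≤ k (+-mono-≤ (*-monoʳ-≤ r (≤-trans k₀≤m (≤-trans (n≤1+n m) (≤-reflexive (sym (M≡ m k₀≤m)))))) (≤-trans (*-monoʳ-≤ w (n≤1+n r)) wR≤k)) ⟩
      k + (r * (i + v) + k)       ≤⟨ m≤m+n _ k ⟩
      k + (r * (i + v) + k) + k   ≡⟨ r4 k (r * (i + v)) ⟩
      r * (i + v) + 3 * k         ∎
      where
      r3 : ∀ a w r → (a + w) * (1 + r) ≡ (a + w) + (r * a + w * r)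
      r3 = solve-∀
      r4 : ∀ k a → k + (a + k) + k ≡ a + 3 * k
      r4 = solve-∀

  massBelow massAbove : ℕ
  massBelow = ∑< (suc w) (mass ∘ (k₀ +_))
  massAbove = ∑< (suc w) (mass ∘ (k +_))

  private
    α β : ℕ
    α = D * (6 * R)
    β = D * (2 * R)

    α+β : α + β ≡ D * (8 * R)
    α+β = ring D R
      where
      ring : ∀ D R → D * (6 * R) + D * (2 * R) ≡ D * (8 * R)
      ring = solve-∀

    bound≡ : ∀ m → bound m ≡ α * mass m + β * mass (suc m)
    bound≡ m = ring N R (mass m) (mass (suc m))
      where
      ring : ∀ N R p q → 2 * (N * (6 * R * p + 2 * R * q)) ≡ 2 * N * (6 * R) * p + 2 * N * (2 * R) * q
      ring = solve-∀

    -- The part of level k under the cutoff is pushed up to an arbitrary level k + i of the upper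
    -- half; i stays free for the averaging in `mass-spread`.
    low-window : ∀ i → i ≤ w → k * (W k * low k) ≤ k * (D * mass (k + i)) + D * (8 * R) * massAbove
    low-window i i≤w = begin
      k * (W k * low k)
        ≤⟨ T.up (λ m → k * (W m * low m)) i
             (λ j j<i → ≤-trans (low-scaled (k + j) (≤-trans (m≤m+n k₀ w) (m≤m+n k j)) (+-monoʳ-< k (<-≤-trans j<i i≤w)))
               (≤-reflexive (cong (k * (W (suc (k + j)) * low (suc (k + j))) +_) (bound≡ (k + j))))) ⟩
      k * (W (k + i) * low (k + i)) + T.bound i
        ≤⟨ +-mono-≤ (*-monoʳ-≤ k (scale (k + i) (low≤ (k + i)))) (T.bound≤ i) ⟩
      k * (D * mass (k + i)) + (α + β) * ∑< (suc i) (mass ∘ (k +_))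
        ≤⟨ +-monoʳ-≤ _ (*-mono-≤ (≤-reflexive α+β) (∑<-≤-∑< (mass ∘ (k +_)) (s≤s i≤w))) ⟩
      k * (D * mass (k + i)) + D * (8 * R) * massAbove ∎
      where
      open ≤-Reasoning
      module T = Telescope mass α β k

    high-window : ∀ i → i ≤ w → k * (W k * high k) ≤ k * (D * mass (k₀ + i)) + D * (8 * R) * massBelow
    high-window i i≤w = begin
      k * (W k * high k)
        ≡⟨ cong (λ t → k * (W t * high t)) a+e≡k ⟨
      k * (W (a + e) * high (a + e))
        ≤⟨ T.down (λ m → k * (W m * high m)) e
             (λ j j<e → ≤-trans (high-scaled (a + j) (≤-trans (m≤m+n k₀ i) (m≤m+n a j)) (<-≤-trans (+-monoʳ-< a j<e) (≤-trans (≤-reflexive a+e≡k) (m≤m+n k w))))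
               (≤-reflexive (cong (k * (W (a + j) * high (a + j)) +_) (bound≡ (a + j))))) ⟩
      k * (W a * high a) + T.bound e
        ≤⟨ +-mono-≤ (*-monoʳ-≤ k (scale a (high≤ a))) (T.bound≤ e) ⟩
      k * (D * mass a) + (α + β) * ∑< (suc e) (mass ∘ (a +_))
        ≤⟨ +-monoʳ-≤ _ (*-mono-≤ (≤-reflexive α+β) tail) ⟩
      k * (D * mass a) + D * (8 * R) * massBelow ∎
      where
      open ≤-Reasoning
      a = k₀ + i
      e = w ∸ i
      module T = Telescope mass α β a
      a+e≡k : a + e ≡ k
      a+e≡k = trans (+-assoc k₀ i e) (cong (k₀ +_) (m+[n∸m]≡n i≤w))
      tail : ∑< (suc e) (mass ∘ (a +_)) ≤ massBelow
      tail = begin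
        ∑< (suc e) (mass ∘ (a +_))                             ≡⟨ ∑<-cong (suc e) (λ j → cong mass (+-assoc k₀ i j)) ⟩
        ∑< (suc e) (mass ∘ (k₀ +_) ∘ (i +_))                   ≤⟨ m≤n+m _ (∑< i (mass ∘ (k₀ +_))) ⟩
        ∑< i (mass ∘ (k₀ +_)) + ∑< (suc e) (mass ∘ (k₀ +_) ∘ (i +_)) ≡⟨ ∑<-append i (suc e) (mass ∘ (k₀ +_)) ⟨
        ∑< (i + suc e) (mass ∘ (k₀ +_))                        ≡⟨ cong (λ t → ∑< t (mass ∘ (k₀ +_))) (trans (+-suc i e) (cong suc (m+[n∸m]≡n i≤w))) ⟩
        massBelow                                              ∎

    -- `low+high` splits the mass at level k: the low part goes up by `low-window`, the high part
    -- goes down by `high-window`. The common factor D = 2nv is positive and cancels.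
    both : ∀ i → i ≤ w → k * mass k ≤ k * (mass (k + i) + mass (k₀ + i)) + 8 * R * (massAbove + massBelow)
    both i i≤w = *-cancelˡ-≤ D ⦃ m*n≢0 2 N ⦃ _ ⦄ ⦃ m*n≢0 n v ⦃ >-nonZero 1≤n ⦄ ⦃ >-nonZero 1≤v ⦄ ⦄ ⦄ (begin
      D * (k * mass k)
        ≡⟨ r1 D k (W k) (count k) ⟩
      k * (W k * (D * count k))
        ≡⟨ cong (λ t → k * (W k * t)) (low+high k) ⟨
      k * (W k * (low k + high k))
        ≡⟨ r2 k (W k) (low k) (high k) ⟩
      k * (W k * low k) + k * (W k * high k)
        ≤⟨ +-mono-≤ (low-window i i≤w) (high-window i i≤w) ⟩
      (k * (D * mass (k + i)) + D * (8 * R) * massAbove) + (k * (D * mass (k₀ + i)) + D * (8 * R) * massBelow)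
        ≡⟨ r3 k D (mass (k + i)) (mass (k₀ + i)) R massAbove massBelow ⟩
      D * (k * (mass (k + i) + mass (k₀ + i)) + 8 * R * (massAbove + massBelow)) ∎)
      where
      open ≤-Reasoning
      r1 : ∀ D k W a → D * (k * (W * a)) ≡ k * (W * (D * a))
      r1 = solve-∀
      r2 : ∀ k W a b → k * (W * (a + b)) ≡ k * (W * a) + k * (W * b)
      r2 = solve-∀
      r3 : ∀ k D x y R a b → (k * (D * x) + D * (8 * R) * a) + (k * (D * y) + D * (8 * R) * b) ≡ D * (k * (x + y) + 8 * R * (a + b))
      r3 = solve-∀

  -- Summing `both` over the w + 1 values of i yields kX from the target levels and 8(w + 1)RX ≤ 8kX
  -- from the errors, in total 9kX.
  mass-spread : suc w * mass k ≤ 9 * (massAbove + massBelow)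
  mass-spread = *-cancelˡ-≤ k ⦃ >-nonZero 1≤k ⦄ (begin
    k * (suc w * mass k)
      ≡⟨ *-swap k (suc w) (mass k) ⟩
    suc w * (k * mass k)
      ≡⟨ ∑<-const (suc w) (k * mass k) ⟨
    ∑< (suc w) (λ _ → k * mass k)
      ≤⟨ ∑<-mono (suc w) (λ i i<u → both i (s≤s⁻¹ i<u)) ⟩
    ∑< (suc w) (λ i → k * (mass (k + i) + mass (k₀ + i)) + 8 * R * X)
      ≡⟨ ∑<-+ (suc w) (λ i → k * (mass (k + i) + mass (k₀ + i))) (λ _ → 8 * R * X) ⟩
    ∑< (suc w) (λ i → k * (mass (k + i) + mass (k₀ + i))) + ∑< (suc w) (λ _ → 8 * R * X)
      ≡⟨ cong₂ _+_ (trans (∑<-* (suc w) k (λ i → mass (k + i) + mass (k₀ + i))) (cong (k *_) (∑<-+ (suc w) (mass ∘ (k +_)) (mass ∘ (k₀ +_))))) (∑<-const (suc w) (8 * R * X)) ⟩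
    k * X + suc w * (8 * R * X)
      ≡⟨ cong (k * X +_) (r2 (suc w) R X) ⟩
    k * X + suc w * R * (8 * X)
      ≤⟨ +-monoʳ-≤ (k * X) (*-monoˡ-≤ (8 * X) uR≤k) ⟩
    k * X + k * (8 * X)
      ≡⟨ r3 k X ⟩
    k * (9 * X) ∎)
    where
    open ≤-Reasoning
    X = massAbove + massBelow
    r2 : ∀ u R X → u * (8 * R * X) ≡ u * R * (8 * X)
    r2 = solve-∀
    r3 : ∀ k X → k * X + k * (8 * X) ≡ k * (9 * X)
    r3 = solve-∀

-- First hitting of a degree sum

lt : ℕ → ℕ → ℕ
lt a b = 𝟙 (a <ᵇ b)

lt-suc : ∀ a b → lt a (suc b) ≡ lt a b + δ a b
lt-suc zero    zero    = refl
lt-suc zero    (suc b) = refl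
lt-suc (suc a) zero    = refl
lt-suc (suc a) (suc b) = lt-suc a b

lt-anti : ∀ {a a′} b → a ≤ a′ → lt a′ b ≤ lt a b
lt-anti zero          z≤n       = ≤-refl
lt-anti {a′ = a′} (suc b) z≤n   = 𝟙≤1 (a′ <ᵇ suc b)
lt-anti zero          (s≤s _)   = z≤n
lt-anti (suc b)       (s≤s a≤a′) = lt-anti b a≤a′

lt-< : ∀ {a b} → a < b → lt a b ≡ 1
lt-< {zero}  (s≤s _)         = refl
lt-< {suc a} {suc b} (s≤s a<b) = lt-< {a} {b} a<b

-- At most one summand on the left is nonzero, and each forces s < t; for the second this is because
-- `sgn d` = 1 means d > 0.
lt-+ : ∀ s d t → lt (s + (d + d)) t + sgn d * δ (s + (d + d)) t ≤ lt s t
lt-+ s zero    t = ≤-reflexive (trans (+-identityʳ _) (cong (λ x → lt x t) (+-identityʳ s)))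
lt-+ s (suc d) t = begin
  lt S t + 1 * δ S t     ≡⟨ cong (lt S t +_) (+-identityʳ _) ⟩
  lt S t + δ S t         ≡⟨ lt-suc S t ⟨
  lt S (suc t)           ≤⟨ lt-anti (suc t) (≤-trans (s≤s (m≤m+n s (d + suc d))) (≤-reflexive (sym (+-suc s (d + suc d))))) ⟩
  lt (suc s) (suc t)     ∎
  where
  open ≤-Reasoning
  S = s + (suc d + suc d)

δ-subst : ∀ a b (f : ℕ → ℕ) → δ a b * f a ≡ δ a b * f b
δ-subst a b f with a ≡ᵇ b in eq
... | false = refl
... | true  = cong (λ t → 1 * f t) (≡ᵇ⇒≡ a b (subst T (sym eq) tt))

∑<-δ : ∀ x t → ∑< t (λ v → v * δ x v) ≡ x * lt x t
∑<-δ x zero    = sym (*-zeroʳ x)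
∑<-δ x (suc t) = begin
  ∑< t (λ v → v * δ x v) + t * δ x t   ≡⟨ cong₂ _+_ (∑<-δ x t) (trans (*-comm t (δ x t)) (trans (sym (δ-subst x t (λ y → y))) (*-comm (δ x t) x))) ⟩
  x * lt x t + x * δ x t             ≡⟨ *-distribˡ-+ x (lt x t) (δ x t) ⟨
  x * (lt x t + δ x t)               ≡⟨ cong (x *_) (lt-suc x t) ⟨
  x * lt x (suc t)                   ∎
  where open ≡-Reasoning

∑ₛ-∑< : ∀ t (f : ℕ → Subset n → ℕ) → ∑ₛ (λ A → ∑< t (λ v → f v A)) ≡ ∑< t (λ v → ∑ₛ (f v))
∑ₛ-∑< {n} zero f = ∑ₛ-zero n
∑ₛ-∑< (suc t) f = trans (∑ₛ-+ (λ A → ∑< t (λ v → f v A)) (f t)) (cong (_+ ∑ₛ (f t)) (∑ₛ-∑< t f))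

∑ₛ-empty : ∀ n → ∑ₛ {n} (λ A → δ (∣ A ∣) 0) ≡ 1
∑ₛ-empty zero    = refl
∑ₛ-empty (suc n) = cong₂ _+_ (∑ₛ-zero n) (∑ₛ-empty n)

module Hitting (G : Graph n) (s : ℕ) where

  sparse exact : ℕ → Subset n → ℕ
  sparse j A = δ (∣ A ∣) j * lt (degreeSum G A) s
  exact  j A = δ (∣ A ∣) j * δ (degreeSum G A) s

  -- The factor ν in `hits` counts the choices of a last vertex at which the degree sum reaches s
  -- for the first time.
  sparseCount hits : ℕ → ℕ
  sparseCount j = ∑ₛ (sparse j)
  hits        j = ∑ₛ (λ A → exact j A * nonisolated G A)

  sparse-─ : ∀ m A {x} → lookup A x ≡ true →
    sparse (suc m) A + sgn (deg G A x) * exact (suc m) A ≤ sparse m (A ─ x)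
  sparse-─ m A {x} x∈A rewrite ∣∣-─ A x∈A | degreeSum-─ G A x∈A = ≤-trans
    (≤-reflexive (collect (δ (∣ A ─ x ∣) m) _ (sgn (deg G A x)) _))
    (*-monoʳ-≤ (δ (∣ A ─ x ∣) m) (lt-+ (degreeSum G (A ─ x)) (deg G A x) s))
    where
    collect : ∀ a b c d → a * b + c * (a * d) ≡ a * (b + c * d)
    collect = solve-∀

  -- Deleting a non-isolated vertex from a set of degree sum s makes the degree sum drop below s.
  hit-step : ∀ m → suc m * sparseCount (suc m) + hits (suc m) ≤ n * sparseCount m
  hit-step m = begin
    suc m * sparseCount (suc m) + hits (suc m)
      ≡⟨ cong (_+ hits (suc m)) (∑ₛ-* (suc m) (sparse (suc m))) ⟨
    ∑ₛ (λ A → suc m * sparse (suc m) A) + hits (suc m)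
      ≡⟨ ∑ₛ-+ (λ A → suc m * sparse (suc m) A) (λ A → exact (suc m) A * nonisolated G A) ⟨
    ∑ₛ (λ A → suc m * sparse (suc m) A + exact (suc m) A * nonisolated G A)
      ≤⟨ ∑ₛ-mono spread ⟩
    ∑ₛ (λ A → sum (λ x → 𝟙 (lookup A x) * sparse m (A ─ x)))
      ≡⟨ ∑ₛ-delete (λ B _ → sparse m B) ⟨
    ∑ₛ (λ B → sum (λ x → 𝟙 (not (lookup B x)) * sparse m B))
      ≤⟨ ∑ₛ-mono total ⟩
    ∑ₛ (λ B → n * sparse m B)
      ≡⟨ ∑ₛ-* n (sparse m) ⟩
    n * sparseCount m ∎
    where
    open ≤-Reasoning
    total : ∀ B → sum (λ x → 𝟙 (not (lookup B x)) * sparse m B) ≤ n * sparse m B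
    total B = begin
      sum (λ x → 𝟙 (not (lookup B x)) * sparse m B)  ≡⟨ *-distribʳ-sum (sparse m B) (λ x → 𝟙 (not (lookup B x))) ⟨
      sum (λ x → 𝟙 (not (lookup B x))) * sparse m B  ≤⟨ *-monoˡ-≤ (sparse m B) (sum-mono (λ x → 𝟙≤1 (not (lookup B x)))) ⟩
      sum {n} (λ _ → 1) * sparse m B                 ≡⟨ cong (_* sparse m B) (sum-one {n} (λ _ → refl)) ⟩
      n * sparse m B                                 ∎
    pointwise : ∀ A x → el A x * sparse (suc m) A + el A x * sgn (deg G A x) * exact (suc m) A ≤ 𝟙 (lookup A x) * sparse m (A ─ x)
    pointwise A x with lookup A x in eq
    ... | false = z≤n
    ... | true  = ≤-trans (≤-reflexive (cong₂ _+_ (+-identityʳ _) (cong (_* exact (suc m) A) (+-identityʳ (sgn (deg G A x))))))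
      (≤-trans (sparse-─ m A eq) (≤-reflexive (sym (+-identityʳ _))))
    spread : ∀ A → suc m * sparse (suc m) A + exact (suc m) A * nonisolated G A ≤ sum (λ x → 𝟙 (lookup A x) * sparse m (A ─ x))
    spread A = begin
      suc m * sparse (suc m) A + exact (suc m) A * nonisolated G A
        ≡⟨ cong₂ _+_ size (*-comm (exact (suc m) A) (nonisolated G A)) ⟩
      sum (el A) * sparse (suc m) A + nonisolated G A * exact (suc m) A
        ≡⟨ cong₂ _+_ (*-distribʳ-sum (sparse (suc m) A) (el A)) (*-distribʳ-sum (exact (suc m) A) (λ x → el A x * sgn (deg G A x))) ⟩
      sum (λ x → el A x * sparse (suc m) A) + sum (λ x → el A x * sgn (deg G A x) * exact (suc m) A)
        ≡⟨ ∑-distrib-+ (λ x → el A x * sparse (suc m) A) (λ x → el A x * sgn (deg G A x) * exact (suc m) A) ⟨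
      sum (λ x → el A x * sparse (suc m) A + el A x * sgn (deg G A x) * exact (suc m) A)
        ≤⟨ sum-mono (pointwise A) ⟩
      sum (λ x → 𝟙 (lookup A x) * sparse m (A ─ x)) ∎
      where
      size : suc m * sparse (suc m) A ≡ sum (el A) * sparse (suc m) A
      size = begin-equality
        suc m * (d * l)     ≡⟨ *-swap (suc m) d l ⟩
        d * (suc m * l)     ≡⟨ δ-subst (∣ A ∣) (suc m) (_* l) ⟨
        d * (∣ A ∣ * l)      ≡⟨ cong (λ t → d * (t * l)) (∣∣≡sum A) ⟩
        d * (sum (el A) * l) ≡⟨ *-swap (sum (el A)) d l ⟨
        sum (el A) * (d * l) ∎
        where
        d = δ (∣ A ∣) (suc m)
        l = lt (degreeSum G A) s

  sparseCount-zero : sparseCount 0 ≤ 1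
  sparseCount-zero = ≤-trans
    (∑ₛ-mono (λ A → ≤-trans (*-monoʳ-≤ (δ (∣ A ∣) 0) (𝟙≤1 (degreeSum G A <ᵇ s))) (≤-reflexive (*-identityʳ _))))
    (≤-reflexive (∑ₛ-empty n))

  module _ (L : ℕ) where
    private
      W : ℕ → ℕ
      W = weight n L

    hit-step-scaled : ∀ {m} → m < L → W (suc m) * hits (suc m) + L * (W (suc m) * sparseCount (suc m)) ≤ L * (W m * sparseCount m)
    hit-step-scaled {m} m<L with weight-step n {L} {m} m<L
    ... | V , Wm≡ , WM≡ rewrite Wm≡ | WM≡ = begin
      suc m * V * hits (suc m) + L * (suc m * V * sparseCount (suc m))
        -- The factor 1/j of the hitting inequality is lowered to 1/L, which gives `hits` the same
        -- weights W as the masses.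
        ≤⟨ +-monoˡ-≤ _ (*-monoˡ-≤ (hits (suc m)) (*-monoˡ-≤ V m<L)) ⟩
      L * V * hits (suc m) + L * (suc m * V * sparseCount (suc m))
        ≡⟨ r1 L V (hits (suc m)) (suc m) (sparseCount (suc m)) ⟩
      L * V * (suc m * sparseCount (suc m) + hits (suc m))
        ≤⟨ *-monoʳ-≤ (L * V) (hit-step m) ⟩
      L * V * (n * sparseCount m)
        ≡⟨ r2 L V n (sparseCount m) ⟩
      L * (n * V * sparseCount m) ∎
      where
      open ≤-Reasoning
      r1 : ∀ L V h M c → L * V * h + L * (M * V * c) ≡ L * V * (M * c + h)
      r1 = solve-∀
      r2 : ∀ L V n c → L * V * (n * c) ≡ L * (n * V * c)
      r2 = solve-∀

    -- The hitting inequality times L n^L. The sum accounts for the sequences that reach degree sum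
    -- s by step t, the last term for those still below s.
    hits-telescope : ∀ t → t ≤ L → ∑< t (λ i → W (suc i) * hits (suc i)) + L * (W t * sparseCount t) ≤ L * n ^ L
    hits-telescope zero    _   = *-monoʳ-≤ L (begin
      1 * n ^ L * sparseCount 0  ≤⟨ *-monoʳ-≤ (1 * n ^ L) sparseCount-zero ⟩
      1 * n ^ L * 1              ≡⟨ trans (*-identityʳ _) (+-identityʳ _) ⟩
      n ^ L                      ∎)
      where open ≤-Reasoning
    hits-telescope (suc t) t<L = begin
      ∑< t (λ i → W (suc i) * hits (suc i)) + W (suc t) * hits (suc t) + L * (W (suc t) * sparseCount (suc t))
        ≡⟨ +-assoc (∑< t (λ i → W (suc i) * hits (suc i))) _ _ ⟩
      ∑< t (λ i → W (suc i) * hits (suc i)) + (W (suc t) * hits (suc t) + L * (W (suc t) * sparseCount (suc t)))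
        ≤⟨ +-monoʳ-≤ _ (hit-step-scaled t<L) ⟩
      ∑< t (λ i → W (suc i) * hits (suc i)) + L * (W t * sparseCount t)
        ≤⟨ hits-telescope t (<⇒≤ t<L) ⟩
      L * n ^ L ∎
      where open ≤-Reasoning

  -- The last term of `hits-telescope` at L = t = k, where the weight is k!.
  sparseCount≤ : ∀ k → .{{NonZero k}} → sparseCount k * k ! ≤ n ^ k
  sparseCount≤ k = *-cancelˡ-≤ k (begin
    k * (sparseCount k * k !)
      ≡⟨ cong (k *_) (trans (*-comm (sparseCount k) (k !)) (cong (_* sparseCount k) (sym (trans (cong (λ t → k ! * n ^ t) (n∸n≡0 k)) (*-identityʳ (k !)))))) ⟩
    k * (weight n k k * sparseCount k)
      ≤⟨ m≤n+m _ (∑< k (λ i → weight n k (suc i) * hits (suc i))) ⟩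
    ∑< k (λ i → weight n k (suc i) * hits (suc i)) + k * (weight n k k * sparseCount k)
      ≤⟨ hits-telescope k k ≤-refl ⟩
    k * n ^ k ∎)
    where open ≤-Reasoning

  hits-window : ∀ {L} a u → a + u ≤ L → ∑< u (λ i → weight n L (suc a + i) * hits (suc a + i)) ≤ L * n ^ L
  hits-window {L} a u a+u≤L = begin
    ∑< u (λ i → f (a + i))            ≤⟨ m≤n+m _ (∑< a f) ⟩
    ∑< a f + ∑< u (λ i → f (a + i))   ≡⟨ ∑<-append a u f ⟨
    ∑< (a + u) f                      ≤⟨ m≤m+n _ _ ⟩
    ∑< (a + u) f + L * (weight n L (a + u) * sparseCount (a + u)) ≤⟨ hits-telescope L (a + u) a+u≤L ⟩
    L * n ^ L                         ∎
    where
    open ≤-Reasoning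
    f : ℕ → ℕ
    f i = weight n L (suc i) * hits (suc i)

  -- On exact sets ν ≤ `degreeSum` = s, so the values v from 0 to s exhaust all cases.
  hits-by-nonisolated : ∀ j → hits j ≡ ∑< (suc s) (λ v → v * Levels.count G s v j)
  hits-by-nonisolated j = begin
    ∑ₛ (λ A → exact j A * nonisolated G A)
      ≡⟨ ∑ₛ-cong split ⟩
    ∑ₛ (λ A → ∑< (suc s) (λ v → v * (Levels.cls G s v j A * 1)))
      ≡⟨ ∑ₛ-∑< (suc s) (λ v A → v * (Levels.cls G s v j A * 1)) ⟩
    ∑< (suc s) (λ v → ∑ₛ (λ A → v * (Levels.cls G s v j A * 1)))
      ≡⟨ ∑<-cong (suc s) (λ v → ∑ₛ-* v (λ A → Levels.cls G s v j A * 1)) ⟩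
    ∑< (suc s) (λ v → v * Levels.count G s v j) ∎
    where
    open ≡-Reasoning
    split : ∀ A → exact j A * nonisolated G A ≡ ∑< (suc s) (λ v → v * (Levels.cls G s v j A * 1))
    split A = sym (begin
      ∑< (suc s) (λ v → v * (a * (δ ν v * b) * 1))    ≡⟨ ∑<-cong (suc s) (λ v → ring v a (δ ν v) b) ⟩
      ∑< (suc s) (λ v → a * b * (v * δ ν v))          ≡⟨ ∑<-* (suc s) (a * b) (λ v → v * δ ν v) ⟩
      a * b * ∑< (suc s) (λ v → v * δ ν v)            ≡⟨ cong (a * b *_) (∑<-δ ν (suc s)) ⟩
      a * b * (ν * lt ν (suc s))                    ≡⟨ *-assoc a b _ ⟩
      a * (b * (ν * lt ν (suc s)))                  ≡⟨ cong (a *_) (δ-subst (degreeSum G A) s (λ t → ν * lt ν (suc t))) ⟨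
      a * (b * (ν * lt ν (suc (degreeSum G A))))    ≡⟨ cong (λ t → a * (b * (ν * t))) (lt-< (s≤s (nonisolated≤degreeSum G A))) ⟩
      a * (b * (ν * 1))                               ≡⟨ ring′ a b ν ⟩
      a * b * ν                                       ∎)
      where
      a = δ (∣ A ∣) j
      b = δ (degreeSum G A) s
      ν = nonisolated G A
      ring : ∀ v a d b → v * (a * (d * b) * 1) ≡ a * b * (v * d)
      ring = solve-∀
      ring′ : ∀ a b ν → a * (b * (ν * 1)) ≡ a * b * ν
      ring′ = solve-∀

-- Handshake

module _ {X : Set} (t : X → Bool) where

  countᵇ-∷ : ∀ x xs → length (filterᵇ t (x List.∷ xs)) ≡ 𝟙 (t x) + length (filterᵇ t xs)
  countᵇ-∷ x xs with t x
  ... | true  = refl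
  ... | false = refl

  countᵇ-++ : ∀ xs ys → length (filterᵇ t (xs List.++ ys)) ≡ length (filterᵇ t xs) + length (filterᵇ t ys)
  countᵇ-++ List.[]       ys = refl
  countᵇ-++ (x List.∷ xs) ys = begin
    length (filterᵇ t (x List.∷ (xs List.++ ys)))                    ≡⟨ countᵇ-∷ x _ ⟩
    𝟙 (t x) + length (filterᵇ t (xs List.++ ys))                     ≡⟨ cong (𝟙 (t x) +_) (countᵇ-++ xs ys) ⟩
    𝟙 (t x) + (length (filterᵇ t xs) + length (filterᵇ t ys))        ≡⟨ +-assoc (𝟙 (t x)) _ _ ⟨
    𝟙 (t x) + length (filterᵇ t xs) + length (filterᵇ t ys)          ≡⟨ cong (_+ length (filterᵇ t ys)) (countᵇ-∷ x xs) ⟨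
    length (filterᵇ t (x List.∷ xs)) + length (filterᵇ t ys)         ∎
    where open ≡-Reasoning

countᵇ-row : {X Y Z : Set} (t : Z → Bool) (f : X → Y → Z) (x : X) (h : Fin n → Y) →
  length (filterᵇ t (List.map (f x) (List.tabulate h))) ≡ sum (λ j → 𝟙 (t (f x (h j))))
countᵇ-row {zero}  t f x h = refl
countᵇ-row {suc n} t f x h = trans (countᵇ-∷ t (f x (h zero)) _) (cong (𝟙 (t (f x (h zero))) +_) (countᵇ-row t f x (h ∘ suc)))

countᵇ-product : ∀ {m} {X Y : Set} (t : X × Y → Bool) (g : Fin m → X) (h : Fin n → Y) →
  length (filterᵇ t (cartesianProduct (List.tabulate g) (List.tabulate h))) ≡ sum (λ i → sum (λ j → 𝟙 (t (g i , h j))))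
countᵇ-product {m = zero}  t g h = refl
countᵇ-product {m = suc m} t g h = trans
  (countᵇ-++ t (List.map (g zero ,_) (List.tabulate h)) _)
  (cong₂ _+_ (countᵇ-row t _,_ (g zero) h) (countᵇ-product t (g ∘ suc) h))

𝟙-∧ : ∀ a b → 𝟙 (a ∧ b) ≡ 𝟙 a * 𝟙 b
𝟙-∧ true  b = sym (+-identityʳ (𝟙 b))
𝟙-∧ false b = refl

<ᵇ-trichotomy : ∀ a b → a ≢ b → 𝟙 (a <ᵇ b) + 𝟙 (b <ᵇ a) ≡ 1
<ᵇ-trichotomy zero    zero    a≢b = ⊥-elim (a≢b refl)
<ᵇ-trichotomy zero    (suc b) _   = refl
<ᵇ-trichotomy (suc a) zero    _   = refl
<ᵇ-trichotomy (suc a) (suc b) a≢b = <ᵇ-trichotomy a b (a≢b ∘ cong suc)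

module _ (G : Graph n) where

  -- `edgesIn` counts the pairs with i < j. The transposed sum supplies those with j < i, and the
  -- diagonal vanishes because there are no loops.
  degreeSum≡2edges : ∀ A → degreeSum G A ≡ 2 * edgesIn G A
  degreeSum≡2edges A = sym (begin
    2 * edgesIn G A
      ≡⟨ cong (2 *_) edges ⟩
    2 * S
      ≡⟨ cong (S +_) (trans (+-identityʳ S) (∑-comm (λ i j → ordered i j * F i j))) ⟩
    S + sum (λ i → sum (λ j → ordered j i * F j i))
      ≡⟨ ∑-distrib-+ (λ i → sum (λ j → ordered i j * F i j)) (λ i → sum (λ j → ordered j i * F j i)) ⟨
    sum (λ i → sum (λ j → ordered i j * F i j) + sum (λ j → ordered j i * F j i))
      ≡⟨ sum-cong-≗ (λ i → ∑-distrib-+ (λ j → ordered i j * F i j) (λ j → ordered j i * F j i)) ⟨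
    sum (λ i → sum (λ j → ordered i j * F i j + ordered j i * F j i))
      ≡⟨ sum-cong-≗ (λ i → trans (sum-cong-≗ (merge i)) (sym (*-distribˡ-sum (el A i) (λ j → el A j * edge G i j)))) ⟩
    degreeSum G A ∎)
    where
    open ≡-Reasoning
    F ordered : Fin n → Fin n → ℕ
    F i j = el A i * (el A j * edge G i j)
    ordered i j = 𝟙 (toℕ i <ᵇ toℕ j)
    S = sum (λ i → sum (λ j → ordered i j * F i j))
    edges : edgesIn G A ≡ S
    edges = trans (countᵇ-product (λ (i , j) → (toℕ i <ᵇ toℕ j) ∧ (lookup A i ∧ (lookup A j ∧ adj G i j))) id id) (sum-cong-≗ (λ i → sum-cong-≗ (λ j →
      trans (𝟙-∧ (toℕ i <ᵇ toℕ j) _) (cong (ordered i j *_) (trans (𝟙-∧ (lookup A i) _) (cong (el A i *_) (𝟙-∧ (lookup A j) _)))))))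
    F-sym : ∀ i j → F j i ≡ F i j
    F-sym i j = trans (cong (λ e → el A j * (el A i * e)) (edge-sym G j i)) (*-swap (el A j) (el A i) (edge G i j))
    merge : ∀ i j → ordered i j * F i j + ordered j i * F j i ≡ F i j
    merge i j with i ≟ᶠ j
    ... | yes refl = trans (cong (λ f → ordered i i * f + ordered i i * f) F≡0) (trans (cong₂ _+_ (*-zeroʳ (ordered i i)) (*-zeroʳ (ordered i i))) (sym F≡0))
      where
      F≡0 : F i i ≡ 0
      F≡0 = trans (cong (λ e → el A i * (el A i * e)) (edge-irrefl G i)) (trans (cong (el A i *_) (*-zeroʳ (el A i))) (*-zeroʳ (el A i)))
    ... | no i≢j = begin
      ordered i j * F i j + ordered j i * F j i   ≡⟨ cong (λ f → ordered i j * F i j + ordered j i * f) (F-sym i j) ⟩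
      ordered i j * F i j + ordered j i * F i j   ≡⟨ *-distribʳ-+ (F i j) (ordered i j) (ordered j i) ⟨
      (ordered i j + ordered j i) * F i j         ≡⟨ cong (_* F i j) (<ᵇ-trichotomy (toℕ i) (toℕ j) (i≢j ∘ toℕ-injective)) ⟩
      1 * F i j                                   ≡⟨ +-identityʳ _ ⟩
      F i j                                       ∎

  -- Forests

  neighbour≢ : ∀ A x z → 2 ≤ deg G A x → ∃ λ y → y ≢ z × lookup A y ≡ true × adj G x y ≡ true
  neighbour≢ A x z 2≤d with any? (λ y → ¬? (y ≟ᶠ z) ×-dec ((lookup A y ≟ᵇ true) ×-dec (adj G x y ≟ᵇ true)))
  ... | yes found = found
  ... | no none   = ⊥-elim (<⇒≱ 2≤d (begin
    deg G A x                     ≤⟨ sum-mono pointwise ⟩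
    sum (λ y → point z y * 1)     ≡⟨ sum-point z (λ _ → 1) ⟩
    1                             ∎))
    where
    open ≤-Reasoning
    pointwise : ∀ y → el A y * edge G x y ≤ point z y * 1
    pointwise y with y ≟ᶠ z | lookup A y in y∈A | adj G x y in xy
    ... | yes _  | a     | e     = *-mono-≤ (𝟙≤1 a) (𝟙≤1 e)
    ... | no _   | false | _     = z≤n
    ... | no _   | true  | false = z≤n
    ... | no y≢z | true  | true  = ⊥-elim (none (y , y≢z , y∈A , xy))

  -- `CycleIn` without `closing`: t + 2 distinct vertices, hence at least one edge. Paths grow at
  -- `vert zero`.
  record Path (A : Subset n) (t : ℕ) : Set where
    field
      vert : Fin (suc (suc t)) → Fin n
      inj  : Injective _≡_ _≡_ vert
      inA  : ∀ i → lookup A (vert i) ≡ true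
      step : ∀ (i : Fin (suc t)) → adj G (vert (inject₁ i)) (vert (suc i)) ≡ true

  -- The chord from `vert zero` to the vertex of index i + 2 closes the first i + 3 vertices to a
  -- cycle; since `CycleIn G A m` has m + 2 vertices, m = i + 1.
  closeUp : ∀ {A t} (P : Path A t) (i : Fin t) →
    adj G (Path.vert P zero) (Path.vert P (suc (suc i))) ≡ true → CycleIn G A (suc (toℕ i))
  closeUp {A} {t} P i chord = record
    { vert    = vert ∘ ι
    ; inj     = λ {a} {b} eq → inject≤-injective short short a b (inj eq)
    ; inA     = λ a → inA (ι a)
    ; step    = λ a → subst (λ b → adj G (vert b) (vert (suc (inject≤ a (s≤s⁻¹ short)))) ≡ true) (inject₁-inject≤ a) (step (inject≤ a (s≤s⁻¹ short)))
    ; closing = trans (cong (λ b → adj G (vert b) (vert zero)) last) (trans (adj-sym G _ _) chord)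
    }
    where
    open Path P
    short : suc (suc (suc (toℕ i))) ≤ suc (suc t)
    short = s≤s (s≤s (toℕ<n i))
    ι : Fin (suc (suc (suc (toℕ i)))) → Fin (suc (suc t))
    ι a = inject≤ a short
    inject₁-inject≤ : ∀ a → inject₁ (inject≤ a (s≤s⁻¹ short)) ≡ ι (inject₁ a)
    inject₁-inject≤ a = toℕ-injective (trans (toℕ-inject₁ _) (trans (toℕ-inject≤ a _) (sym (trans (toℕ-inject≤ (inject₁ a) short) (toℕ-inject₁ a)))))
    last : ι (fromℕ (suc (suc (toℕ i)))) ≡ suc (suc i)
    last = toℕ-injective (trans (toℕ-inject≤ (fromℕ (suc (suc (toℕ i)))) short) (toℕ-fromℕ (suc (suc (toℕ i)))))

  extend : ∀ {A t} (P : Path A t) {y} → lookup A y ≡ true → adj G y (Path.vert P zero) ≡ true →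
    (∀ i → Path.vert P i ≢ y) → Path A (suc t)
  extend {A} {t} P {y} y∈A edge fresh = record { vert = vert′ ; inj = inj′ ; inA = inA′ ; step = step′ }
    where
    open Path P
    vert′ : Fin (suc (suc (suc t))) → Fin n
    vert′ zero    = y
    vert′ (suc i) = vert i
    inj′ : Injective _≡_ _≡_ vert′
    inj′ {zero}  {zero}  _  = refl
    inj′ {zero}  {suc j} eq = ⊥-elim (fresh j (sym eq))
    inj′ {suc i} {zero}  eq = ⊥-elim (fresh i eq)
    inj′ {suc i} {suc j} eq = cong suc (inj eq)
    inA′ : ∀ i → lookup A (vert′ i) ≡ true
    inA′ zero    = y∈A
    inA′ (suc i) = inA i
    step′ : ∀ i → adj G (vert′ (inject₁ i)) (vert′ (suc i)) ≡ true
    step′ zero    = edge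
    step′ (suc i) = step i

  deg-positive : ∀ A {x y} → lookup A y ≡ true → adj G x y ≡ true → 1 ≤ deg G A x
  deg-positive A {x} {y} y∈A xy = ≤-trans (≤-reflexive (cong₂ (λ a b → 𝟙 a * 𝟙 b) (sym y∈A) (sym xy)))
    (sum-term (λ z → el A z * edge G x z) y)

  module _ (A : Subset n) (forest : IsForest G A)
    (no-leaf : ∀ x → lookup A x ≡ true → deg G A x ≢ 1) where

    -- Without leaves, the first vertex of a path has a neighbour y other than its successor. If y
    -- lies on the path it closes a cycle; otherwise the path grows, and once the fuel is used up it
    -- has more than n vertices.
    no-path : ∀ fuel t → n < fuel + suc (suc t) → ¬ Path A t
    no-path zero       t n<t P = <⇒≱ n<t (injective⇒≤ (Path.inj P))
    no-path (suc fuel) t n<t P with neighbour≢ A (vert zero) (vert (suc zero)) (≤∧≢⇒< (deg-positive A (inA (suc zero)) (step zero)) (≢-sym (no-leaf (vert zero) (inA zero))))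
      where open Path P
    ... | y , y≢next , y∈A , edge with any? (λ i → Path.vert P i ≟ᶠ y)
    ...   | no fresh = no-path fuel (suc t) (≤-trans n<t (≤-reflexive (sym (+-suc fuel _)))) (extend P y∈A (trans (adj-sym G _ _) edge) (λ i eq → fresh (i , eq)))
    ...   | yes (zero , refl) with () ← trans (sym (adj-irrfl G y)) edge
    ...   | yes (suc zero , eq)    = y≢next (sym eq)
    ...   | yes (suc (suc i) , refl) = forest (suc (toℕ i)) (s≤s z≤n) (closeUp P i edge)

    all-isolated : ∀ x → lookup A x ≡ true → deg G A x ≡ 0
    all-isolated x x∈A with deg G A x in eq
    ... | zero        = refl
    ... | suc zero    = ⊥-elim (no-leaf x x∈A eq)
    ... | suc (suc d) with neighbour≢ A x x (subst (2 ≤_) (sym eq) (s≤s (s≤s z≤n)))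
    ...   | y , y≢x , y∈A , edge = ⊥-elim (no-path n 0 (≤-trans (n<1+n n) (≤-trans (n≤1+n _) (≤-reflexive (+-comm 2 n)))) P)
      where
      vert : Fin 2 → Fin n
      vert zero       = x
      vert (suc zero) = y
      inj : Injective _≡_ _≡_ vert
      inj {zero}     {zero}     _  = refl
      inj {zero}     {suc zero} eq = ⊥-elim (y≢x (sym eq))
      inj {suc zero} {zero}     eq = ⊥-elim (y≢x eq)
      inj {suc zero} {suc zero} _  = refl
      P : Path A 0
      P = record { vert = vert ; inj = inj ; inA = λ { zero → x∈A ; (suc zero) → y∈A } ; step = λ { zero → edge } }

  IsForest-─ : ∀ A x → IsForest G A → IsForest G (A ─ x)
  IsForest-─ A x forest m 1≤m C = forest m 1≤m (record
    { vert = vert ; inj = inj ; inA = λ i → lookup-─-⊆ A x (inA i) ; step = step ; closing = closing })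
    where open CycleIn C

  -- Deleting a leaf lowers the degree sum by exactly 2 and ν by at least 1. A forest without leaves
  -- has no edges, by `all-isolated`.
  forest-degreeSum : ∀ fuel A → ∣ A ∣ ≤ fuel → IsForest G A → degreeSum G A ≤ 2 * nonisolated G A
  forest-degreeSum fuel A size forest with any? (λ x → (lookup A x ≟ᵇ true) ×-dec (deg G A x ≟ 1))
  forest-degreeSum fuel A size forest | no none = ≤-trans (≤-reflexive (sum-zero zeros)) z≤n
    where
    zeros : ∀ x → el A x * deg G A x ≡ 0
    zeros x with lookup A x in x∈A
    ... | false = refl
    ... | true  = trans (+-identityʳ _) (all-isolated A forest (λ y y∈A d≡1 → none (y , y∈A , d≡1)) x x∈A)
  forest-degreeSum zero A size forest | yes (x , x∈A , d≡1) with () ← ≤-trans (≤-reflexive (sym (∣∣-─ A x∈A))) size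
  forest-degreeSum (suc fuel) A size forest | yes (x , x∈A , d≡1) = begin
    degreeSum G A                                ≡⟨ degreeSum-─ G A x∈A ⟩
    degreeSum G (A ─ x) + (deg G A x + deg G A x) ≡⟨ cong (λ d → degreeSum G (A ─ x) + (d + d)) d≡1 ⟩
    degreeSum G (A ─ x) + 2                      ≤⟨ +-monoˡ-≤ 2 (forest-degreeSum fuel (A ─ x) (s≤s⁻¹ (≤-trans (≤-reflexive (sym (∣∣-─ A x∈A))) size)) (IsForest-─ A x forest)) ⟩
    2 * nonisolated G (A ─ x) + 2                ≡⟨ *-distribˡ-+ 2 (nonisolated G (A ─ x)) 1 ⟨
    2 * (nonisolated G (A ─ x) + 1)              ≡⟨ cong (λ d → 2 * (nonisolated G (A ─ x) + sgn d)) d≡1 ⟨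
    2 * (nonisolated G (A ─ x) + sgn (deg G A x)) ≤⟨ *-monoʳ-≤ 2 (nonisolated-─ G A x∈A) ⟩
    2 * nonisolated G A                          ∎
    where open ≤-Reasoning

  forest-edges≤nonisolated : ∀ A → IsForest G A → edgesIn G A ≤ nonisolated G A
  forest-edges≤nonisolated A forest = *-cancelˡ-≤ 2 (≤-trans (≤-reflexive (sym (degreeSum≡2edges A))) (forest-degreeSum (∣ A ∣) A ≤-refl forest))

-- Choice of the window

∑<-comm : ∀ s t (f : ℕ → ℕ → ℕ) → ∑< s (λ i → ∑< t (f i)) ≡ ∑< t (λ j → ∑< s (λ i → f i j))
∑<-comm zero    t f = sym (trans (∑<-const t 0) (*-zeroʳ t))
∑<-comm (suc s) t f = trans (cong (_+ ∑< t (f s)) (∑<-comm s t f)) (sym (∑<-+ t (λ j → ∑< s (λ i → f i j)) (f s)))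

module _ (G : Graph n) (s k₁ w r : ℕ) (1≤n : 1 ≤ n) (s≤R² : s ≤ suc r * suc r)
  (uR≤k : suc w * suc r ≤ suc k₁ + w) (k₀-large : w + 2 * s ≤ suc k₁) where

  open Hitting G s

  private
    k = suc k₁ + w
    L = k + w
    W : ℕ → ℕ
    W = weight n L

    massᵥ : ℕ → ℕ → ℕ
    massᵥ v j = W j * Levels.count G s v j

    window : ℕ → ℕ → ℕ
    window a v = ∑< (suc w) (massᵥ v ∘ (a +_))

    spread : ∀ v → v < suc s → v * (suc w * massᵥ v k) ≤ v * (9 * (window k v + window (suc k₁) v))
    -- The class v = 0 carries weight 0; `Window` asks for v ≥ 1, so that the cutoff height 2nv is
    -- positive.
    spread zero    _   = z≤n
    spread (suc v) v<s = *-monoʳ-≤ (suc v) (Window.mass-spread G s (suc v) (suc k₁) w r (s≤s z≤n) 1≤n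
      (≤-trans (s≤s⁻¹ v<s) s≤R²) uR≤k (≤-trans (+-monoʳ-≤ w (*-monoʳ-≤ 2 (s≤s⁻¹ v<s))) k₀-large))


    ∑-mass : ∀ j → ∑< (suc s) (λ v → v * massᵥ v j) ≡ W j * hits j
    ∑-mass j = begin
      ∑< (suc s) (λ v → v * (W j * Levels.count G s v j))    ≡⟨ ∑<-cong (suc s) (λ v → *-swap v (W j) _) ⟩
      ∑< (suc s) (λ v → W j * (v * Levels.count G s v j))    ≡⟨ ∑<-* (suc s) (W j) (λ v → v * Levels.count G s v j) ⟩
      W j * ∑< (suc s) (λ v → v * Levels.count G s v j)      ≡⟨ cong (W j *_) (hits-by-nonisolated j) ⟨
      W j * hits j                                           ∎
      where open ≡-Reasoning

    ∑-window : ∀ a → ∑< (suc s) (λ v → v * window a v) ≡ ∑< (suc w) (λ i → W (a + i) * hits (a + i))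
    ∑-window a = begin
      ∑< (suc s) (λ v → v * window a v)
        ≡⟨ ∑<-cong (suc s) (λ v → ∑<-* (suc w) v (massᵥ v ∘ (a +_))) ⟨
      ∑< (suc s) (λ v → ∑< (suc w) (λ i → v * massᵥ v (a + i)))
        ≡⟨ ∑<-comm (suc s) (suc w) (λ v i → v * massᵥ v (a + i)) ⟩
      ∑< (suc w) (λ i → ∑< (suc s) (λ v → v * massᵥ v (a + i)))
        ≡⟨ ∑<-cong (suc w) (λ i → ∑-mass (a + i)) ⟩
      ∑< (suc w) (λ i → W (a + i) * hits (a + i)) ∎
      where open ≡-Reasoning

  -- Summing `mass-spread` over v with weight v turns masses into `hits`. Each of the two windows
  -- then holds at most L n^L by `hits-window`, and 18 = 9 · 2.
  hits-concentration : suc w * (W k * hits k) ≤ 18 * (L * n ^ L)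
  hits-concentration = begin
    suc w * (W k * hits k)
      ≡⟨ cong (suc w *_) (∑-mass k) ⟨
    suc w * ∑< (suc s) (λ v → v * massᵥ v k)
      ≡⟨ ∑<-* (suc s) (suc w) (λ v → v * massᵥ v k) ⟨
    ∑< (suc s) (λ v → suc w * (v * massᵥ v k))
      ≡⟨ ∑<-cong (suc s) (λ v → *-swap (suc w) v (massᵥ v k)) ⟩
    ∑< (suc s) (λ v → v * (suc w * massᵥ v k))
      ≤⟨ ∑<-mono (suc s) spread ⟩
    ∑< (suc s) (λ v → v * (9 * (window k v + window (suc k₁) v)))
      ≡⟨ ∑<-cong (suc s) (λ v → expand v (window k v) (window (suc k₁) v)) ⟩
    ∑< (suc s) (λ v → 9 * (v * window k v + v * window (suc k₁) v))
      ≡⟨ trans (∑<-* (suc s) 9 (λ v → v * window k v + v * window (suc k₁) v)) (cong (9 *_) (∑<-+ (suc s) (λ v → v * window k v) (λ v → v * window (suc k₁) v))) ⟩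
    9 * (∑< (suc s) (λ v → v * window k v) + ∑< (suc s) (λ v → v * window (suc k₁) v))
      ≡⟨ cong (9 *_) (cong₂ _+_ (∑-window k) (∑-window (suc k₁))) ⟩
    9 * (∑< (suc w) (λ i → W (k + i) * hits (k + i)) + ∑< (suc w) (λ i → W (suc k₁ + i) * hits (suc k₁ + i)))
      -- `hits-window a` starts at level a + 1: the upper window from k has a = k₁ + w, the lower
      -- one from `suc k₁` has a = k₁.
      ≤⟨ *-monoʳ-≤ 9 (+-mono-≤ (hits-window (k₁ + w) (suc w) (≤-reflexive (+-suc (k₁ + w) w)))
           (hits-window k₁ (suc w) (≤-trans (≤-reflexive (+-suc k₁ w)) (m≤m+n k w)))) ⟩
    9 * (L * n ^ L + L * n ^ L)
      ≡⟨ nine (L * n ^ L) ⟩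
    18 * (L * n ^ L) ∎
    where
    open ≤-Reasoning
    expand : ∀ v a b → v * (9 * (a + b)) ≡ 9 * (v * a + v * b)
    expand = solve-∀
    nine : ∀ x → 9 * (x + x) ≡ 18 * x
    nine = solve-∀

  hits-bound : suc w * (k ! * hits k) ≤ 18 * (L * n ^ k)
  hits-bound = *-cancelʳ-≤ _ _ (n ^ w) ⦃ m^n≢0 n w ⦃ >-nonZero 1≤n ⦄ ⦄ (begin
    suc w * (k ! * hits k) * n ^ w          ≡⟨ r1 (suc w) (k !) (hits k) (n ^ w) ⟩
    suc w * (k ! * n ^ w * hits k)          ≡⟨ cong (λ t → suc w * (k ! * n ^ t * hits k)) (m+n∸m≡n k w) ⟨
    suc w * (W k * hits k)                  ≤⟨ hits-concentration ⟩
    18 * (L * n ^ L)                        ≡⟨ cong (λ t → 18 * (L * t)) (^-distribˡ-+-* n k w) ⟩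
    18 * (L * (n ^ k * n ^ w))              ≡⟨ r2 L (n ^ k) (n ^ w) ⟩
    18 * (L * n ^ k) * n ^ w                ∎)
    where
    open ≤-Reasoning
    r1 : ∀ u f h x → u * (f * h) * x ≡ u * (f * x * h)
    r1 = solve-∀
    r2 : ∀ L a b → 18 * (L * (a * b)) ≡ 18 * (L * a) * b
    r2 = solve-∀

floor-sqrt : ∀ m → ∃ λ r → r * r ≤ m × m < suc r * suc r
floor-sqrt zero = 0 , z≤n , s≤s z≤n
floor-sqrt (suc m) with floor-sqrt m
... | r , r²≤m , m<r₁² with suc r * suc r ≤? suc m
...   | yes r₁²≤ = suc r , r₁²≤ , ≤-<-trans m<r₁² (*-mono-< (n<1+n (suc r)) (n<1+n (suc r)))
...   | no  ≰    = r , m≤n⇒m≤1+n r²≤m , ≰⇒> ≰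

-- R = r + 1 is the least integer above √(2ℓ). The three bounds serve v ≤ 2ℓ ≤ R² in the windows,
-- the final constant, and 4w ≤ k.
root-exists : ∀ ℓ → 36 ≤ ℓ → ∃ λ r → 2 * ℓ ≤ suc r * suc r × (2 + r) * (2 + r) ≤ 3 * ℓ × 4 ≤ suc r
root-exists ℓ 36≤ℓ with floor-sqrt (2 * ℓ)
... | r , r²≤ , <R² = r , <⇒≤ <R² , bound , 4≤R
  where
  open ≤-Reasoning
  4≤R : 4 ≤ suc r
  4≤R with 4 ≤? suc r
  ... | yes p = p
  ... | no  p = ⊥-elim (<⇒≱ <R² (≤-trans (*-mono-≤ (<⇒≤ (≰⇒> p)) (<⇒≤ (≰⇒> p))) (≤-trans (m≤m+n 16 56) (*-monoʳ-≤ 2 36≤ℓ))))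
  -- For r ≤ 8 the left side is at most 36, the lower bound on ℓ; for r ≥ 9 it is at most r²/2 ≤ ℓ.
  slack : 4 * suc r ≤ ℓ
  slack with r ≤? 8
  ... | yes r≤8 = ≤-trans (*-monoʳ-≤ 4 (s≤s r≤8)) 36≤ℓ
  ... | no  r≰8 = *-cancelˡ-≤ 2 (begin
    2 * (4 * suc r)   ≡⟨ r1 r ⟩
    8 + 8 * r         ≤⟨ +-monoˡ-≤ (8 * r) (<⇒≤ (≰⇒> r≰8)) ⟩
    r + 8 * r         ≤⟨ *-monoˡ-≤ r (≰⇒> r≰8) ⟩
    r * r             ≤⟨ r²≤ ⟩
    2 * ℓ             ∎)
    where
    r1 : ∀ r → 2 * (4 * (1 + r)) ≡ 8 + 8 * r
    r1 = solve-∀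
  bound : (2 + r) * (2 + r) ≤ 3 * ℓ
  bound = begin
    (2 + r) * (2 + r)     ≡⟨ r2 r ⟩
    r * r + 4 * suc r     ≤⟨ +-mono-≤ r²≤ slack ⟩
    2 * ℓ + ℓ             ≡⟨ r3 ℓ ⟩
    3 * ℓ                 ∎
    where
    r2 : ∀ r → (2 + r) * (2 + r) ≡ r * r + 4 * (1 + r)
    r2 = solve-∀
    r3 : ∀ l → 2 * l + l ≡ 3 * l
    r3 = solve-∀

-- The width w + 1 is u = ⌊k/R⌋. From R² ≤ k follows R ≤ u, so that k < R + uR ≤ u(R + 1).
window-exists : ∀ k r → suc r * suc r ≤ k → ∃ λ w → suc w * suc r ≤ k × k ≤ suc w * (2 + r)
window-exists k r R²≤k = help (k / R) (m/n*n≤m k R) k≤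
  where
  open ≤-Reasoning
  R = suc r
  k≤ : k < R + k / R * R
  k≤ = ≤-<-trans (≤-reflexive (m≡m%n+[m/n]*n k R)) (+-monoˡ-< (k / R * R) (m%n<n k R))
  help : ∀ u → u * R ≤ k → k < R + u * R → ∃ λ w → suc w * R ≤ k × k ≤ suc w * (2 + r)
  help u u≤ k< with R ≤? u
  help (suc w) u≤ k< | yes R≤u = w , u≤ , (begin
    k                     ≤⟨ <⇒≤ k< ⟩
    R + suc w * R         ≤⟨ +-monoˡ-≤ (suc w * R) R≤u ⟩
    suc w + suc w * R     ≡⟨ *-suc (suc w) R ⟨
    suc w * (2 + r)       ∎)
  help u u≤ k< | no R≰u with () ← <⇒≱ k< (≤-trans (*-monoˡ-≤ R (≰⇒> R≰u)) R²≤k)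

-- Weights of forests and the final estimate

δ-refl : ∀ a → δ a a ≡ 1
δ-refl zero    = refl
δ-refl (suc a) = δ-refl a

square : ∀ x → x ^ 2 ≡ x * x
square x = cong (x *_) (*-identityʳ x)

ForestOn : Graph n → ℕ → ℕ → Subset n → Set
ForestOn G k ℓ A = (∣ A ∣ ≡ k) × (IsForest G A × (edgesIn G A ≡ ℓ))

forest-sparse : (G : Graph n) → ∀ {k ℓ} A → ForestOn G k ℓ A → 1 ≤ Hitting.sparse G (suc (2 * ℓ)) k A
forest-sparse G A (refl , _ , refl) = ≤-reflexive (sym (cong₂ _*_ (δ-refl (∣ A ∣))
  (lt-< (s≤s (≤-reflexive (degreeSum≡2edges G A))))))

-- Each forest weighs ν ≥ ℓ in `hits`; this factor ℓ against R of order √ℓ yields ℓ^(-1/2).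
forest-exact : (G : Graph n) → ∀ {k ℓ} A → ForestOn G k ℓ A → ℓ ≤ Hitting.exact G (2 * ℓ) k A * nonisolated G A
forest-exact G A (refl , forest , refl) = begin
  edgesIn G A                    ≤⟨ forest-edges≤nonisolated G A forest ⟩
  nonisolated G A                ≡⟨ +-identityʳ _ ⟨
  1 * nonisolated G A            ≡⟨ cong (_* nonisolated G A) (cong₂ _*_ (δ-refl (∣ A ∣)) (trans (cong (λ t → δ t (2 * edgesIn G A)) (degreeSum≡2edges G A)) (δ-refl (2 * edgesIn G A)))) ⟨
  Hitting.exact G (2 * edgesIn G A) (∣ A ∣) A * nonisolated G A ∎
  where open ≤-Reasoning

module _ {k ℓ n : ℕ} (1≤k : 1 ≤ k) (1≤ℓ : 1 ≤ ℓ) (16ℓ²≤k : 16 * (ℓ * ℓ) ≤ k) (k≤n : k ≤ n)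
  (G : Graph n) {As : List (Subset n)} (unique : Unique As) (forests : All (ForestOn G k ℓ) As) where

  private
    P = length As * k !
    N = n ^ k
    open ≤-Reasoning

  N² : N ^ 2 ≡ n ^ (2 * k)
  N² = trans (^-*-assoc n k 2) (cong (n ^_) (*-comm k 2))

  -- Up to ℓ = 2500 = 50² the factor 50 ℓ^(-1/2) is at least 1, and the trivial bound n^k / k! on
  -- the number of sets is enough.
  few-edges : ℓ ≤ 2500 → P ^ 2 * ℓ ≤ 2500 * n ^ (2 * k)
  few-edges ℓ≤2500 = begin
    P ^ 2 * ℓ          ≤⟨ *-mono-≤ (^-monoˡ-≤ 2 P≤N) ℓ≤2500 ⟩
    N ^ 2 * 2500       ≡⟨ *-comm (N ^ 2) 2500 ⟩
    2500 * N ^ 2       ≡⟨ cong (2500 *_) N² ⟩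
    2500 * n ^ (2 * k) ∎
    where
    open Hitting G (suc (2 * ℓ))
    P≤N : P ≤ N
    P≤N = begin
      length As * k !          ≡⟨ cong (_* k !) (+-identityʳ (length As)) ⟨
      1 * length As * k !      ≤⟨ *-monoˡ-≤ (k !) (length-weight 1 (sparse k) unique (All.map (λ {A} → forest-sparse G A) forests)) ⟩
      sparseCount k * k !      ≤⟨ sparseCount≤ k ⦃ >-nonZero 1≤k ⦄ ⟩
      n ^ k                    ∎

  -- Squaring ℓP ≤ 27(R + 1)N and inserting (R + 1)² ≤ 3ℓ leaves one factor ℓ to cancel.
  many-edges : 36 ≤ ℓ → P ^ 2 * ℓ ≤ 2500 * n ^ (2 * k)
  many-edges 36≤ℓ with root-exists ℓ 36≤ℓ
  ... | r , 2ℓ≤R² , R₁²≤3ℓ , 4≤R with window-exists k r (≤-trans (*-mono-≤ (n≤1+n (suc r)) (n≤1+n (suc r))) (≤-trans R₁²≤3ℓ 3ℓ≤k))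
    where
    3ℓ≤k : 3 * ℓ ≤ k
    3ℓ≤k = ≤-trans (*-mono-≤ (m≤m+n 3 13) (m≤m*n ℓ ℓ ⦃ >-nonZero 1≤ℓ ⦄)) 16ℓ²≤k
  ...   | w , uR≤k , k≤uR₁ = *-cancelˡ-≤ ℓ ⦃ >-nonZero 1≤ℓ ⦄ (begin
    ℓ * (P ^ 2 * ℓ)                   ≡⟨ cong (λ t → ℓ * (t * ℓ)) (square P) ⟩
    ℓ * (P * P * ℓ)                   ≡⟨ q1 ℓ P ⟩
    (ℓ * P) * (ℓ * P)                 ≤⟨ *-mono-≤ ℓP≤ ℓP≤ ⟩
    27 * (2 + r) * N * (27 * (2 + r) * N) ≡⟨ q2 (2 + r) N ⟩
    729 * ((2 + r) * (2 + r)) * (N * N) ≤⟨ *-monoˡ-≤ (N * N) (*-monoʳ-≤ 729 R₁²≤3ℓ) ⟩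
    729 * (3 * ℓ) * (N * N)           ≡⟨ cong (729 * (3 * ℓ) *_) (trans (sym (square N)) N²) ⟩
    729 * (3 * ℓ) * n ^ (2 * k)       ≡⟨ q3 ℓ (n ^ (2 * k)) ⟩
    -- 27² · 3 = 2187, which fits under 50² = 2500.
    ℓ * (2187 * n ^ (2 * k))          ≤⟨ *-monoʳ-≤ ℓ (*-monoˡ-≤ (n ^ (2 * k)) (m≤m+n 2187 313)) ⟩
    ℓ * (2500 * n ^ (2 * k))          ∎)
    where
    q1 : ∀ l P → l * (P * P * l) ≡ (l * P) * (l * P)
    q1 = solve-∀
    q2 : ∀ R N → 27 * R * N * (27 * R * N) ≡ 729 * (R * R) * (N * N)
    q2 = solve-∀
    q3 : ∀ l x → 729 * (3 * l) * x ≡ l * (2187 * x)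
    q3 = solve-∀
    4w≤k : 4 * w ≤ k
    4w≤k = begin
      4 * w             ≤⟨ *-mono-≤ 4≤R (n≤1+n w) ⟩
      suc r * suc w     ≡⟨ *-comm (suc r) (suc w) ⟩
      suc w * suc r     ≤⟨ uR≤k ⟩
      k                 ∎
    8ℓ≤k : 8 * ℓ ≤ k
    8ℓ≤k = ≤-trans (*-mono-≤ (m≤m+n 8 8) (m≤m*n ℓ ℓ ⦃ >-nonZero 1≤ℓ ⦄)) 16ℓ²≤k
    -- This is w + 2s ≤ k - w for s = 2ℓ, the room that the windows require below level k.
    room : w + 2 * (2 * ℓ) + w ≤ k
    room = *-cancelˡ-≤ 2 (begin
      2 * (w + 2 * (2 * ℓ) + w)   ≡⟨ q4 w ℓ ⟩
      4 * w + 8 * ℓ               ≤⟨ +-mono-≤ 4w≤k 8ℓ≤k ⟩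
      k + k                       ≡⟨ cong (k +_) (+-identityʳ k) ⟨
      2 * k                       ∎)
      where
      q4 : ∀ w l → 2 * (w + 2 * (2 * l) + w) ≡ 4 * w + 8 * l
      q4 = solve-∀
    -- k has to be written as `suc k₁` + w for `hits-bound`; k₀ = 0 is impossible because 4ℓ ≤ k₀.
    concentrate : ∀ k₀ → k₀ + w ≡ k → w + 2 * (2 * ℓ) ≤ k₀ → suc w * (k ! * Hitting.hits G (2 * ℓ) k) ≤ 18 * ((k + w) * n ^ k)
    concentrate zero     eq le with () ← ≤-trans 1≤ℓ (≤-trans (m≤n*m ℓ 4) (≤-trans (≤-reflexive (*-assoc 2 2 ℓ)) (≤-trans (m≤n+m _ w) le)))
    concentrate (suc k₁) refl le = hits-bound G (2 * ℓ) k₁ w r (≤-trans 1≤k k≤n) 2ℓ≤R² uR≤k le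
    -- 2 · 18(k + w) ≤ 18 · 3k = 54k as 2w ≤ k, and k ≤ (w + 1)(2 + r); halving 54 leaves 27.
    ℓP≤ : ℓ * P ≤ 27 * (2 + r) * N
    ℓP≤ = *-cancelˡ-≤ (2 * suc w) (begin
      2 * suc w * (ℓ * P)
        ≡⟨ q5 (suc w) ℓ (length As) (k !) ⟩
      2 * (suc w * (k ! * (ℓ * length As)))
        ≤⟨ *-monoʳ-≤ 2 (*-monoʳ-≤ (suc w) (*-monoʳ-≤ (k !) (length-weight ℓ _ unique (All.map (λ {A} → forest-exact G A) forests)))) ⟩
      2 * (suc w * (k ! * Hitting.hits G (2 * ℓ) k))
        ≤⟨ *-monoʳ-≤ 2 (concentrate (k ∸ w) (m∸n+n≡m (≤-trans (m≤n+m w _) room)) (m+n≤o⇒m≤o∸n _ room)) ⟩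
      2 * (18 * ((k + w) * N))
        ≡⟨ q6 k w N ⟩
      18 * (2 * k + 2 * w) * N
        ≤⟨ *-monoˡ-≤ N (*-monoʳ-≤ 18 (+-monoʳ-≤ (2 * k) (≤-trans (*-monoˡ-≤ w (m≤m+n 2 2)) 4w≤k))) ⟩
      18 * (2 * k + k) * N
        ≡⟨ q7 k N ⟩
      54 * k * N
        ≤⟨ *-monoˡ-≤ N (*-monoʳ-≤ 54 k≤uR₁) ⟩
      54 * (suc w * (2 + r)) * N
        ≡⟨ q8 (suc w) (2 + r) N ⟩
      2 * suc w * (27 * (2 + r) * N) ∎)
      where
      q5 : ∀ u l a f → 2 * u * (l * (a * f)) ≡ 2 * (u * (f * (l * a)))
      q5 = solve-∀
      q6 : ∀ k w N → 2 * (18 * ((k + w) * N)) ≡ 18 * (2 * k + 2 * w) * N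
      q6 = solve-∀
      q7 : ∀ k N → 18 * (2 * k + k) * N ≡ 54 * k * N
      q7 = solve-∀
      q8 : ∀ u R N → 54 * (u * R) * N ≡ 2 * u * (27 * R * N)
      q8 = solve-∀

theorem1p6 : (k ℓ n : ℕ) → 1 ≤ k → 1 ≤ ℓ → 16 * (ℓ * ℓ) ≤ k → k ≤ n →
    (G : Graph n) → (As : List (Subset n)) → Unique As →
    All (λ A → (∣ A ∣ ≡ k) × (IsForest G A × (edgesIn G A ≡ ℓ))) As →
    ((length As * (k !)) ^ 2) * ℓ ≤ 2500 * (n ^ (2 * k))
theorem1p6 k ℓ n 1≤k 1≤ℓ 16ℓ²≤k k≤n G As unique forests with ≤-total ℓ 2500
... | inj₁ ℓ≤2500 = few-edges 1≤k 1≤ℓ 16ℓ²≤k k≤n G unique forests ℓ≤2500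
... | inj₂ 2500≤ℓ = many-edges 1≤k 1≤ℓ 16ℓ²≤k k≤n G unique forests (≤-trans (m≤m+n 36 2464) 2500≤ℓ)
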